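{- For every integer $n\ge 66$ with $n\equiv 2 \pmod 8$ there exists a cyclically $5$-connected strictly critical snark of girth $6$ and order $n$.
   Context: A snark is a connected cubic graph with chromatic index $4$. A snark is critical if, for every pair of distinct adjacent vertices, the graph obtained by removing these two vertices is $3$-edge-colourable; it is bicritical if the same holds for every pair of distinct vertices; it is strictly critical if it is critical but not bicritical. A cubic graph is cyclically $k$-connected if no set of fewer than $k$ edges separates two cycles of the graph from each other. The girth is the length of a shortest cycle. -}

module Defs where

open import Data.Nat using (ℕ; zero; suc; _<_; _≤_)
open import Data.Fin using (Fin; inject₁; fromℕ) renaming (zero to fz; suc to fs)
open import Data.Bool using (Bool; true; false; T; not; _∧_)
open import Data.List using (List; length)
open import Data.List.Membership.Propositional using (_∈_)
open import Data.Product using (Σ; _×_; _,_; ∃)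
open import Relation.Binary.PropositionalEquality using (_≡_; _≢_)
open import Relation.Nullary using (¬_)
open import Function.Definitions using (Injective)

record Graph (n : ℕ) : Set where
  field
    adj   : Fin n → Fin n → Bool
    sym   : ∀ u v → adj u v ≡ adj v u
    irref : ∀ u → adj u u ≡ false
open Graph public

Adj : ∀ {n} → Graph n → Fin n → Fin n → Set
Adj G u v = T (adj G u v)

Cubic : ∀ {n} → Graph n → Set
Cubic {n} G = ∀ v → Σ (Fin n) λ a → Σ (Fin n) λ b → Σ (Fin n) λ c →
  Adj G v a × Adj G v b × Adj G v c × a ≢ b × a ≢ c × b ≢ c ×
  (∀ w → Adj G v w → (w ≡ a) ⊎' (w ≡ b) ⊎' (w ≡ c))
  where
  open import Data.Sum using () renaming (_⊎_ to _⊎'_)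

data Reach {n : ℕ} (E : Fin n → Fin n → Set) : Fin n → Fin n → Set where
  here : ∀ {u} → Reach E u u
  step : ∀ {u v w} → E u v → Reach E v w → Reach E u w

Connected : ∀ {n} → Graph n → Set
Connected G = ∀ u v → Reach (Adj G) u v

record CycleIn {n : ℕ} (E : Fin n → Fin n → Set) : Set where
  field
    m     : ℕ
    vtx   : Fin (suc (suc (suc m))) → Fin n
    inj   : Injective _≡_ _≡_ vtx
    edges : ∀ (i : Fin (suc (suc m))) → E (vtx (inject₁ i)) (vtx (fs i))
    close : E (vtx (fromℕ (suc (suc m)))) (vtx fz)
open CycleIn public

cycleLength : ∀ {n} {E : Fin n → Fin n → Set} → CycleIn E → ℕ
cycleLength C = suc (suc (suc (m C)))

HasCycleOfLength : ∀ {n} → Graph n → ℕ → Set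
HasCycleOfLength G ℓ = Σ (CycleIn (Adj G)) λ C → cycleLength C ≡ ℓ

Girth : ∀ {n} → Graph n → ℕ → Set
Girth G g = HasCycleOfLength G g × (∀ ℓ → ℓ < g → ¬ HasCycleOfLength G ℓ)

-- Proper k-edge-colouring of the subgraph induced by the vertices
-- satisfying keep (keep = all vertices gives the whole graph).
-- c u v is the colour of the edge uv (only its values on edges matter).
EdgeColourableOn : ∀ {n} → ℕ → Graph n → (Fin n → Bool) → Set
EdgeColourableOn {n} k G keep =
  Σ (Fin n → Fin n → Fin k) λ c →
    (∀ u v → T (keep u) → T (keep v) → Adj G u v → c u v ≡ c v u) ×
    (∀ u v w → T (keep u) → T (keep v) → T (keep w) →
       Adj G u v → Adj G u w → v ≢ w → c u v ≢ c u w)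

EdgeColourable : ∀ {n} → ℕ → Graph n → Set
EdgeColourable k G = EdgeColourableOn k G (λ _ → true)

ChromaticIndex : ∀ {n} → Graph n → ℕ → Set
ChromaticIndex G k = EdgeColourable k G × (∀ j → j < k → ¬ EdgeColourable j G)

Snark : ∀ {n} → Graph n → Set
Snark G = Connected G × Cubic G × ChromaticIndex G 4

others : ∀ {n} → Fin n → Fin n → Fin n → Bool
others u v x = not (isYes (x Fin≟ u)) ∧ not (isYes (x Fin≟ v))
  where
  open import Data.Fin using () renaming (_≟_ to _Fin≟_)
  open import Relation.Nullary.Decidable using (isYes)

RemovalColourable : ∀ {n} → Graph n → Fin n → Fin n → Set
RemovalColourable G u v = EdgeColourableOn 3 G (others u v)

Critical : ∀ {n} → Graph n → Set
Critical G = Snark G × (∀ u v → u ≢ v → Adj G u v → RemovalColourable G u v)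

Bicritical : ∀ {n} → Graph n → Set
Bicritical G = Snark G × (∀ u v → u ≢ v → RemovalColourable G u v)

StrictlyCritical : ∀ {n} → Graph n → Set
StrictlyCritical G = Critical G × ¬ Bicritical G

AdjMinus : ∀ {n} → Graph n → List (Fin n × Fin n) → Fin n → Fin n → Set
AdjMinus G F u v = Adj G u v × ¬ ((u , v) ∈ F) × ¬ ((v , u) ∈ F)

SeparatesTwoCycles : ∀ {n} → Graph n → List (Fin n × Fin n) → Set
SeparatesTwoCycles G F =
  Σ (CycleIn (AdjMinus G F)) λ C₁ → Σ (CycleIn (AdjMinus G F)) λ C₂ →
    ¬ Reach (AdjMinus G F) (vtx C₁ fz) (vtx C₂ fz)

CyclicallyConnected : ∀ {n} → ℕ → Graph n → Set
CyclicallyConnected k G =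
  ∀ (F : List (_ × _)) → length F < k → ¬ SeparatesTwoCycles G F

{-# OPTIONS --safe #-}
module Submission where

-- Removing a vertex and severing an edge of a flower snark leaves a pole with
-- two and three dangling edges in which the two always receive distinct
-- colours.  Attach three such poles by their pairs to the three pairs of
-- opposite vertices of a hexagon; no 3-edge-colouring of the hexagon has
-- distinct colours on all three pairs.  The nine remaining dangling edges are
-- attached to three further vertices, the hubs, which play no role in this
-- argument, so that the graph stays uncolourable when two hubs are removed.
-- The third pole is a chain of 4 + 2k stars K₁,₃ closed by a bridge b – t – c.
-- Since a colouring may go back and forth along the chain, while two stars
-- permute the colours on the three rails cyclically, k does not matter for
-- colourability; likewise stars can be dropped from the chain without
-- enlarging an edge cut or creating a shorter cycle, which reduces cyclic
-- connectivity and girth to the graph with k = 0, where they are checked by search.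

open import Defs hiding (sym; m)
open import Data.Bool using (Bool; T; _∧_; false; if_then_else_; not; true)
open import Data.Bool.Properties using (T?)
open import Data.Empty using (⊥; ⊥-elim)
open import Data.Fin using (Fin; _↑ʳ_; _↑ˡ_; combine; fromℕ; inject₁; inject≤; join; punchIn; remQuot; splitAt; suc; toℕ; zero)
open import Data.Fin.Induction using (<-weakInduction)
open import Data.Fin.Patterns using (0F; 1F; 2F; 3F; 4F; 5F)
open import Data.Fin.Properties using (all?; any?; combine-remQuot; inject≤-injective; join-splitAt; remQuot-combine; splitAt-↑ʳ; splitAt-↑ˡ; suc-injective; toℕ-fromℕ; toℕ-inject₁; ↑ˡ-injective) renaming (_≟_ to _≟ᶠ_)
open import Data.List using (List; []; _++_; _∷_; allFin; concat; filter; foldr; length; map; tabulate)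
open import Data.List.Membership.DecPropositional using (_∈?_)
open import Data.List.Membership.Propositional using (_∈_)
open import Data.List.Membership.Propositional.Properties using (∈-++⁺ʳ; ∈-++⁺ˡ; ∈-++⁻; ∈-allFin; ∈-filter⁺; ∈-map⁺; ∈-∃++)
open import Data.List.Properties using (length-++; length-map; map-++; map-tabulate)
open import Data.List.Relation.Unary.Any using (here; there)
open import Data.Maybe using (Maybe; just; nothing)
open import Data.Nat using (_%_; _*_; _+_; _/_; _<?_; _<_; _<ᵇ_; _^_; _∸_; _≡ᵇ_; _≤?_; _≤_; _≤ᵇ_; _⊓_; suc; s≤s; zero; z≤n; ℕ)
open import Data.Nat.DivMod using (_mod_; m≡m%n+[m/n]*n)
open import Data.Nat.Induction using (<-wellFounded)
open import Data.Nat.ListAction using (sum)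
open import Data.Nat.ListAction.Properties using (sum-++)
open import Data.Nat.Tactic.RingSolver using (solve-∀)
open import Data.Product using (_,_; _×_; proj₁; proj₂; uncurry; Σ; ∃)
open import Data.Product.Properties using () renaming (≡-dec to ×-≡-dec)
open import Data.Sum using (_⊎_; inj₁; inj₂)
open import Data.Sum.Properties using (inj₁-injective; inj₂-injective) renaming (≡-dec to ⊎-≡-dec)
open import Data.Unit using (tt; ⊤)
open import Function using (_∋_; _∘_; id; mk⇔)
open import Induction.WellFounded using (Acc; acc)
open import Relation.Binary.Construct.Closure.ReflexiveTransitive using (Star; _◅_; _◅◅_; reverse; ε)
open import Relation.Binary.Definitions using (DecidableEquality)
open import Relation.Binary.PropositionalEquality
open import Relation.Nullary using (Dec; does; no; yes; ¬_)
open import Relation.Nullary.Decidable using (True; _×-dec_; _→-dec_; _⊎-dec_; dec-false; dec-true; does-⇔; from-yes; map′; toWitness; ¬?; ¬¬-excluded-middle)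
import Data.Maybe as Maybe
import Data.Nat.Properties as ℕₚ
import Data.Sum as Sum

-- For k = 0 there are 66 vertices: 6 in the hexagon, 3 hubs and 3 poles of 19, each consisting of a
-- bridge and four stars. Two more stars add 8 vertices, hence the residue class. In a pole, `t` is
-- the centre of the remaining star of a flower snark (J₅ for four full stars), and `b` and `c` are
-- its leaves on the two rails that cross there. The third leaf is the removed vertex, and the
-- severed edge joined `b` to the entry of the second rail; its two halves are the pair offered to
-- the hexagon. Equal colours on the halves could be glued, and the crossing of two rails would then
-- be compatible with a cyclic shift of all three, which it is not. Evenness of the number of stars
-- enters only the colouring arguments. The reductions for girth and cyclic connectivity drop one
-- star at a time and pass through chains of both parities, which is why the construction is set up
-- for 4 + m stars with arbitrary m.

decided : ∀ {a} {A : Set a} (a? : Dec A) → T (does a?) → A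
decided (yes a) _ = a

-- Cubic graphs given by an involution on darts

Dart : Set → Set
Dart V = V × Fin 3

-- With darts, an edge colouring is a function that is constant on the orbits of `τ`, and properness
-- is a condition at one vertex at a time. The last two fields exclude multiple edges and loops.
record DartGraph (V : Set) : Set where
  field
    τ      : Dart V → Dart V
    τ-inv  : ∀ d → τ (τ d) ≡ d
  nb : V → Fin 3 → V
  nb v i = proj₁ (τ (v , i))
  rev : V → Fin 3 → Fin 3
  rev v i = proj₂ (τ (v , i))
  field
    nb-injective : ∀ v {i j} → nb v i ≡ nb v j → i ≡ j
    nb-irrefl    : ∀ v i → nb v i ≢ v

  Link : V → V → Set
  Link u v = ∃ λ i → nb u i ≡ v

  link : ∀ v i → Link v (nb v i)
  link v i = i , refl

  nb-rev : ∀ v i → nb (nb v i) (rev v i) ≡ v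
  nb-rev v i = cong proj₁ (τ-inv (v , i))

  link-sym : ∀ {u v} → Link u v → Link v u
  link-sym {u} (i , refl) = rev u i , nb-rev u i

  link-irrefl : ∀ {u v} → Link u v → u ≢ v
  link-irrefl (i , e) refl = nb-irrefl _ i e

record Numbering (V : Set) (n : ℕ) : Set where
  field
    code      : V → Fin n
    vert      : Fin n → V
    vert-code : ∀ v → vert (code v) ≡ v
    code-vert : ∀ x → code (vert x) ≡ x

  code-injective : ∀ {u v} → code u ≡ code v → u ≡ v
  code-injective {u} {v} e = trans (sym (vert-code u)) (trans (cong vert e) (vert-code v))

  vert-injective : ∀ {x y} → vert x ≡ vert y → x ≡ y
  vert-injective {x} {y} e = trans (sym (code-vert x)) (trans (cong code e) (code-vert y))

  _≟ⱽ_ : (u v : V) → Dec (u ≡ v)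
  u ≟ⱽ v = map′ code-injective (cong code) (code u ≟ᶠ code v)

others-true : ∀ {n} {u v x : Fin n} → x ≢ u → x ≢ v → T (others u v x)
others-true {u = u} {v} {x} p q with x ≟ᶠ u | x ≟ᶠ v
... | yes e | _     = p e
... | no _  | yes e = q e
... | no _  | no _  = tt

others-≢ˡ : ∀ {n} {u v x : Fin n} → T (others u v x) → x ≢ u
others-≢ˡ {u = u} {v} {x} t with x ≟ᶠ u
... | no ne = ne

others-≢ʳ : ∀ {n} {u v x : Fin n} → T (others u v x) → x ≢ v
others-≢ʳ {u = u} {v} {x} t with x ≟ᶠ u | x ≟ᶠ v
... | no _ | no ne = ne

module Realise {V : Set} {n : ℕ} (D : DartGraph V) (N : Numbering V n) where
  open DartGraph D
  open Numbering N

  link? : ∀ u v → Dec (Link u v)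
  link? u v = any? (λ i → nb u i ≟ⱽ v)

  graph : Graph n
  graph = record
    { adj   = λ x y → does (link? (vert x) (vert y))
    ; sym   = λ x y → does-⇔ (mk⇔ link-sym link-sym) (link? _ _) (link? _ _)
    ; irref = λ x → dec-false (link? _ _) (λ l → link-irrefl l refl)
    }

  adj⇒link : ∀ {x y} → Adj graph x y → Link (vert x) (vert y)
  adj⇒link {x} {y} = decided (link? (vert x) (vert y))

  link⇒adj : ∀ {x y} → Link (vert x) (vert y) → Adj graph x y
  link⇒adj {x} {y} l = subst T (sym (dec-true (link? (vert x) (vert y)) l)) tt

  link-codes : ∀ {u v} → Link u v → Adj graph (code u) (code v)
  link-codes {u} {v} l = link⇒adj (subst₂ Link (sym (vert-code u)) (sym (vert-code v)) l)

  cubic : Cubic graph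
  cubic x = code (nb v i0) , code (nb v i1) , code (nb v i2)
          , to i0 , to i1 , to i2
          , differ (λ ()) , differ (λ ()) , differ (λ ())
          , complete
    where
    v = vert x
    i0 i1 i2 : Fin 3
    i0 = zero
    i1 = suc zero
    i2 = suc (suc zero)
    to : ∀ i → Adj graph x (code (nb v i))
    to i = link⇒adj (i , sym (vert-code _))
    differ : ∀ {i j} → i ≢ j → code (nb v i) ≢ code (nb v j)
    differ ne e = ne (nb-injective v (code-injective e))
    complete : ∀ y → Adj graph x y → _ ⊎ (_ ⊎ _)
    complete y a with adj⇒link a
    ... | zero           , e = inj₁ (trans (sym (code-vert y)) (cong code (sym e)))
    ... | suc zero       , e = inj₂ (inj₁ (trans (sym (code-vert y)) (cong code (sym e))))
    ... | suc (suc zero) , e = inj₂ (inj₂ (trans (sym (code-vert y)) (cong code (sym e))))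

  connected : (r : V) → (∀ v → Star Link v r) → Connected graph
  connected r toRoot x y = subst₂ (Reach (Adj graph)) (code-vert x) (code-vert y)
    (reach (toRoot (vert x) ◅◅ reverse link-sym (toRoot (vert y))))
    where
    reach : ∀ {u v} → Star Link u v → Reach (Adj graph) (code u) (code v)
    reach ε       = here
    reach (l ◅ p) = step (link-codes l) (reach p)

  port : V → V → Fin 3
  port u v with link? u v
  ... | yes (i , _) = i
  -- An arbitrary value: a port matters only when the two vertices are linked.
  ... | no _        = zero

  port-nb : ∀ {u v} → Link u v → nb u (port u v) ≡ v
  port-nb {u} {v} l with link? u v
  ... | yes (_ , e) = e
  ... | no ¬l       = ⊥-elim (¬l l)

  -- The pair x, y receives the colour of the dart at x that points to y. Invariance under the
  -- involution makes this symmetric, and since the graph is simple, distinct neighbours of x use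
  -- distinct darts.
  colourable : ∀ {k} (γ : V → Fin 3 → Fin k) (keep : Fin n → Bool) →
    (∀ v i → γ (nb v i) (rev v i) ≡ γ v i) →
    (∀ x → T (keep x) → ∀ {i j} → γ (vert x) i ≡ γ (vert x) j → i ≡ j) →
    EdgeColourableOn k graph keep
  colourable γ keep agree proper =
    (λ x y → γ (vert x) (port (vert x) (vert y))) , symmetric , distinct
    where
    symmetric : ∀ x y → T (keep x) → T (keep y) → Adj graph x y → _
    symmetric x y _ _ a = trans (sym (agree u i)) (cong₂ γ ui (nb-injective v (trans back (sym (port-nb (link-sym l))))))
      where
      u = vert x
      v = vert y
      l : Link u v
      l = adj⇒link a
      i = port u v
      ui : nb u i ≡ v
      ui = port-nb l
      back : nb v (rev u i) ≡ u
      back = trans (cong (λ w → nb w (rev u i)) (sym ui)) (nb-rev u i)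
    distinct : ∀ x y z → T (keep x) → T (keep y) → T (keep z) →
               Adj graph x y → Adj graph x z → y ≢ z → _
    distinct x y z kx _ _ a b y≢z e = y≢z (vert-injective
      (trans (sym (port-nb (adj⇒link a)))
        (trans (cong (nb (vert x)) (proper x kx e)) (port-nb (adj⇒link b)))))

  module Colouring {k} {keep : Fin n → Bool} (C : EdgeColourableOn k graph keep) where
    record Kept (v : V) : Set where
      constructor kept
      field
        keeps : T (keep (code v))
    open Kept

    colour : V → Fin 3 → Fin k
    colour v i = proj₁ C (code v) (code (nb v i))

    colour-τ : ∀ v i {w j} → τ (v , i) ≡ (w , j) → Kept v → Kept w → colour v i ≡ colour w j
    colour-τ v i refl kv kw =
      trans (proj₁ (proj₂ C) _ _ (keeps kv) (keeps kw) (link-codes (link v i)))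
            (cong (proj₁ C (code (nb v i)) ∘ code) (sym (nb-rev v i)))

    colour-≢ : ∀ v {i j} → Kept v → Kept (nb v i) → Kept (nb v j) → i ≢ j → colour v i ≢ colour v j
    colour-≢ v {i} {j} kv ki kj i≢j =
      proj₂ (proj₂ C) _ _ _ (keeps kv) (keeps ki) (keeps kj) (link-codes (link v i)) (link-codes (link v j))
        (λ e → i≢j (nb-injective v (code-injective e)))

-- The core: hexagon, hubs, two poles and the bridge of the third

nth : ∀ {a} {A : Set a} → A → List A → ℕ → A
nth z []       _       = z
nth z (x ∷ xs) zero    = x
nth z (x ∷ xs) (suc i) = nth z xs i

Target : Set
Target = Dart (Fin 50) ⊎ (Fin 3 ⊎ Fin 3)

pattern core d  = inj₁ d
pattern left l  = inj₂ (inj₁ l)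
pattern right l = inj₂ (inj₂ l)

-- Row x of the table lists where the three darts of core vertex x lead: the
-- dart i of vertex y has number 3y+i, and 150+l, 153+l stand for leaf l of the
-- first and of the last star of the chain.  Vertices 0–5 form the hexagon,
-- 25–27 are the three hubs, 6–24 and 28–46 are two poles (bridge vertices
-- b, t, c, then four stars, centre first), and 47–49 are b, t, c of the third.
targetNumbers : List ℕ
targetNumbers =
  16 ∷ 3 ∷ 19 ∷ 1 ∷ 6 ∷ 151 ∷ 4 ∷ 9 ∷ 85 ∷ 7 ∷ 12 ∷ 34 ∷ 10 ∷ 15 ∷ 142 ∷
  13 ∷ 0 ∷ 100 ∷ 21 ∷ 2 ∷ 74 ∷ 18 ∷ 24 ∷ 75 ∷ 22 ∷ 37 ∷ 71 ∷ 30 ∷ 33 ∷ 36 ∷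
  27 ∷ 78 ∷ 43 ∷ 28 ∷ 11 ∷ 46 ∷ 29 ∷ 25 ∷ 49 ∷ 42 ∷ 45 ∷ 48 ∷ 39 ∷ 32 ∷ 55 ∷
  40 ∷ 35 ∷ 58 ∷ 41 ∷ 38 ∷ 61 ∷ 54 ∷ 57 ∷ 60 ∷ 51 ∷ 44 ∷ 67 ∷ 52 ∷ 47 ∷ 70 ∷
  53 ∷ 50 ∷ 73 ∷ 66 ∷ 69 ∷ 72 ∷ 63 ∷ 56 ∷ 81 ∷ 64 ∷ 59 ∷ 26 ∷ 65 ∷ 62 ∷ 20 ∷
  23 ∷ 89 ∷ 146 ∷ 31 ∷ 97 ∷ 150 ∷ 68 ∷ 134 ∷ 153 ∷ 87 ∷ 8 ∷ 140 ∷ 84 ∷ 90 ∷ 76 ∷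
  88 ∷ 103 ∷ 137 ∷ 96 ∷ 99 ∷ 102 ∷ 93 ∷ 79 ∷ 109 ∷ 94 ∷ 17 ∷ 112 ∷ 95 ∷ 91 ∷ 115 ∷
  108 ∷ 111 ∷ 114 ∷ 105 ∷ 98 ∷ 121 ∷ 106 ∷ 101 ∷ 124 ∷ 107 ∷ 104 ∷ 127 ∷ 120 ∷ 123 ∷ 126 ∷
  117 ∷ 110 ∷ 133 ∷ 118 ∷ 113 ∷ 136 ∷ 119 ∷ 116 ∷ 139 ∷ 132 ∷ 135 ∷ 138 ∷ 129 ∷ 122 ∷ 82 ∷
  130 ∷ 125 ∷ 92 ∷ 131 ∷ 128 ∷ 86 ∷ 144 ∷ 14 ∷ 155 ∷ 141 ∷ 147 ∷ 77 ∷ 145 ∷ 152 ∷ 154 ∷ []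

opaque
  -- Opaque, so that generic arguments about the chain treat core neighbours as unknowns; the table
  -- is evaluated only in the finite checks that unfold it.
  target : Fin 50 → Fin 3 → Target
  target x i = decode (nth 0 targetNumbers (3 * toℕ x + toℕ i))
    where
    decode : ℕ → Target
    decode c = if c <ᵇ 150 then core ((c / 3) mod 50 , c mod 3)
               else if c <ᵇ 153 then left (c mod 3) else right (c mod 3)

_≟ᵈ_ : DecidableEquality (Dart (Fin 50))
_≟ᵈ_ = ×-≡-dec _≟ᶠ_ _≟ᶠ_

_≟ᵗ_ : DecidableEquality Target
_≟ᵗ_ = ⊎-≡-dec _≟ᵈ_ (⊎-≡-dec _≟ᶠ_ _≟ᶠ_)

-- The first rail runs from hub 26 to hub 27. The second starts at the hexagon vertex 1 and ends at
-- `c` = 49, while the third starts at `c` and ends at `b` = 47: this is the crossing of the flower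
-- snark.
leftPort rightPort : Fin 3 → Dart (Fin 50)
leftPort 0F = 26 mod 50 , 2F
leftPort 1F = 1 mod 50 , 2F
leftPort 2F = 49 mod 50 , 1F
rightPort 0F = 27 mod 50 , 2F
rightPort 1F = 49 mod 50 , 2F
rightPort 2F = 47 mod 50 , 2F

opaque
  unfolding target
  target-left : ∀ l → uncurry target (leftPort l) ≡ left l
  target-left = from-yes (all? λ l → uncurry target (leftPort l) ≟ᵗ left l)

opaque
  unfolding target
  target-right : ∀ l → uncurry target (rightPort l) ≡ right l
  target-right = from-yes (all? λ l → uncurry target (rightPort l) ≟ᵗ right l)

Returns : Dart (Fin 50) → Target → Set
Returns d (core e)  = uncurry target e ≡ core d
Returns d (left l)  = leftPort l ≡ d
Returns d (right l) = rightPort l ≡ d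

returns? : ∀ d t → Dec (Returns d t)
returns? d (core e)  = uncurry target e ≟ᵗ core d
returns? d (left l)  = leftPort l ≟ᵈ d
returns? d (right l) = rightPort l ≟ᵈ d

opaque
  unfolding target
  target-returns : ∀ x i → Returns (x , i) (target x i)
  target-returns = from-yes (all? λ x → all? λ i → returns? (x , i) (target x i))

endpoint : Target → Fin 50 ⊎ (Fin 3 ⊎ Fin 3)
endpoint = Sum.map₁ proj₁

_≟ᵉ_ : DecidableEquality (Fin 50 ⊎ (Fin 3 ⊎ Fin 3))
_≟ᵉ_ = ⊎-≡-dec _≟ᶠ_ (⊎-≡-dec _≟ᶠ_ _≟ᶠ_)

opaque
  unfolding target
  endpoint-injective : ∀ x i j → endpoint (target x i) ≡ endpoint (target x j) → i ≡ j
  endpoint-injective = from-yes (all? λ x → all? λ i → all? λ j →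
    (endpoint (target x i) ≟ᵉ endpoint (target x j)) →-dec (i ≟ᶠ j))

opaque
  unfolding target
  endpoint-irrefl : ∀ x i → endpoint (target x i) ≢ inj₁ x
  endpoint-irrefl = from-yes (all? λ x → all? λ i → ¬? (endpoint (target x i) ≟ᵉ inj₁ x))

-- The graph with 4 + m stars in the chain

prev : ∀ {n} → Fin n → Maybe (Fin n)
prev zero    = nothing
prev (suc i) = just (inject₁ i)

next : ∀ {n} → Fin (suc n) → Maybe (Fin (suc n))
next {zero}  zero    = nothing
next {suc n} zero    = just (suc zero)
next {suc n} (suc i) = Maybe.map suc (next i)

next-inject₁ : ∀ {n} (i : Fin n) → next (inject₁ i) ≡ just (suc i)
next-inject₁ {suc n} zero    = refl
next-inject₁ {suc n} (suc i) = cong (Maybe.map suc) (next-inject₁ i)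

next-fromℕ : ∀ n → next (fromℕ n) ≡ nothing
next-fromℕ zero    = refl
next-fromℕ (suc n) = cong (Maybe.map suc) (next-fromℕ n)

-- `next` does not compute on `fromℕ` or `inject₁`; the view exposes exactly the two shapes to which
-- the equations above apply.
data NextView {n} : Fin (suc n) → Set where
  last : NextView (fromℕ n)
  step : (i : Fin n) → NextView (inject₁ i)

nextView : ∀ {n} (i : Fin (suc n)) → NextView i
nextView {zero}  zero    = last
nextView {suc n} zero    = step zero
nextView {suc n} (suc i) with nextView i
... | last   = last
... | step j = step (suc j)

Vertex : ℕ → Set
Vertex m = Fin 50 ⊎ Fin (4 + m) × Fin 4

pattern base x = inj₁ x
pattern star i l = inj₂ (i , l)

fromTarget : ∀ {m} → Target → Dart (Vertex m)
fromTarget (core (y , j)) = base y , j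
fromTarget (left l)       = star zero (suc l) , 1F
fromTarget (right l)      = star (fromℕ _) (suc l) , 2F

along : ∀ {m} → Fin 4 → Fin 3 → Dart (Fin 50) → Maybe (Fin (4 + m)) → Dart (Vertex m)
along l j (x , i) nothing  = base x , i
along l j _       (just i) = star i l , j

chainτ : ∀ {m} → Dart (Vertex m) → Dart (Vertex m)
chainτ (base x       , i)  = fromTarget (target x i)
chainτ (star i zero    , l)  = star i (suc l) , 0F
chainτ (star i (suc l) , 0F) = star i zero , l
chainτ (star i (suc l) , 1F) = along (suc l) 2F (leftPort l) (prev i)
chainτ (star i (suc l) , 2F) = along (suc l) 1F (rightPort l) (next i)

onBase : ∀ {m} → Dart (Fin 50) → Dart (Vertex m)
onBase (x , i) = base x , i

chainτ-fromTarget : ∀ {m d} t → Returns d t → chainτ {m} (fromTarget t) ≡ onBase d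
chainτ-fromTarget (core e)  r = cong fromTarget r
chainτ-fromTarget (left l)  r = cong onBase r
chainτ-fromTarget (right l) r = trans (cong (along (suc l) 1F (rightPort l)) (next-fromℕ _)) (cong onBase r)

chainτ-involutive : ∀ {m} (d : Dart (Vertex m)) → chainτ (chainτ d) ≡ d
chainτ-involutive (base x , i)                     = chainτ-fromTarget (target x i) (target-returns x i)
chainτ-involutive (star i zero , l)                = refl
chainτ-involutive (star i (suc l) , 0F)            = refl
chainτ-involutive (star zero (suc l) , 1F)         = cong fromTarget (target-left l)
chainτ-involutive (star (suc i) (suc l) , 1F)      = cong (along (suc l) 1F (rightPort l)) (next-inject₁ i)
chainτ-involutive (star i (suc l) , 2F) with nextView i
... | last   = trans (cong (λ n → chainτ (along (suc l) 1F (rightPort l) n)) (next-fromℕ _)) (cong fromTarget (target-right l))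
... | step j = cong (λ n → chainτ (along (suc l) 1F (rightPort l) n)) (next-inject₁ j)

chainNb : ∀ {m} → Vertex m → Fin 3 → Vertex m
chainNb v i = proj₁ (chainτ (v , i))

fromEndpoint : ∀ {m} → Fin 50 ⊎ (Fin 3 ⊎ Fin 3) → Vertex m
fromEndpoint (inj₁ y)  = base y
fromEndpoint (left l)  = star zero (suc l)
fromEndpoint (right l) = star (fromℕ _) (suc l)

fromEndpoint-injective : ∀ {m} a b → fromEndpoint {m} a ≡ fromEndpoint b → a ≡ b
fromEndpoint-injective (inj₁ _)  (inj₁ _)  refl = refl
fromEndpoint-injective (inj₁ _)  (left _)  ()
fromEndpoint-injective (inj₁ _)  (right _) ()
fromEndpoint-injective (left _)  (left _)  refl = refl
fromEndpoint-injective (right _) (right _) refl = refl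

fromTarget-vertex : ∀ {m} t → proj₁ (fromTarget {m} t) ≡ fromEndpoint (endpoint t)
fromTarget-vertex (core _)  = refl
fromTarget-vertex (left _)  = refl
fromTarget-vertex (right _) = refl

chainNb-base : ∀ {m} x i → chainNb {m} (base x) i ≡ fromEndpoint (endpoint (target x i))
chainNb-base x i = fromTarget-vertex (target x i)

prev≢ : ∀ {m} {i : Fin (4 + m)} {l j d k} → proj₁ (along {m} l j d (prev i)) ≡ star i k → ⊥
prev≢ {i = suc i} e with cong toℕ (cong proj₁ (inj₂-injective e))
... | e′ = ℕₚ.1+n≢n (trans (sym e′) (toℕ-inject₁ i))

next≢ : ∀ {m} {i : Fin (4 + m)} {l j d k} → proj₁ (along {m} l j d (next i)) ≡ star i k → ⊥
next≢ {m} {i} {l} {j} {d} e with nextView i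
... | last with trans (sym (cong (proj₁ ∘ along l j d) (next-fromℕ (3 + m)))) e
...   | ()
next≢ {m} {_} {l} {j} {d} e | step i
  with trans (sym (cong (proj₁ ∘ along l j d) (next-inject₁ i))) e
... | e′ = ℕₚ.1+n≢n (trans (cong (toℕ ∘ proj₁) (inj₂-injective e′)) (toℕ-inject₁ i))

-- With at least two stars, the rail neighbours of a leaf are never both ports. Either one is a port
-- and the other a leaf, or they lie on stars whose indices differ by two.
prev≢next : ∀ {m} (i : Fin (4 + m)) {l} → proj₁ (along {m} (suc l) 2F (leftPort l) (prev i)) ≢ proj₁ (along (suc l) 1F (rightPort l) (next i))
prev≢next zero ()
prev≢next {m} (suc i) {l} e with nextView i
... | last with trans e (cong (proj₁ ∘ along (suc l) 1F (rightPort l) ∘ Maybe.map suc) (next-fromℕ _))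
...   | ()
prev≢next {m} (suc _) {l} e | step j
  with cong (toℕ ∘ proj₁) (inj₂-injective (trans e (cong (proj₁ ∘ along (suc l) 1F (rightPort l) ∘ Maybe.map suc) (next-inject₁ j))))
... | e′ = ℕₚ.m≢1+n+m (toℕ j) {1} (trans (sym (trans (toℕ-inject₁ (inject₁ j)) (toℕ-inject₁ j))) e′)

chainNb-injective : ∀ {m} (v : Vertex m) {i j} → chainNb v i ≡ chainNb v j → i ≡ j
chainNb-injective (base x) {i} {j} e = endpoint-injective x i j
  (fromEndpoint-injective _ _ (trans (sym (chainNb-base x i)) (trans e (chainNb-base x j))))
chainNb-injective (star i zero) refl = refl
chainNb-injective (star i (suc l)) {0F} {0F} e = refl
chainNb-injective (star i (suc l)) {1F} {1F} e = refl
chainNb-injective (star i (suc l)) {2F} {2F} e = refl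
chainNb-injective (star i (suc l)) {0F} {1F} e = ⊥-elim (prev≢ (sym e))
chainNb-injective (star i (suc l)) {0F} {2F} e = ⊥-elim (next≢ (sym e))
chainNb-injective (star i (suc l)) {1F} {0F} e = ⊥-elim (prev≢ e)
chainNb-injective (star i (suc l)) {2F} {0F} e = ⊥-elim (next≢ e)
chainNb-injective (star i (suc l)) {1F} {2F} e = ⊥-elim (prev≢next i e)
chainNb-injective (star i (suc l)) {2F} {1F} e = ⊥-elim (prev≢next i (sym e))

chainNb-irrefl : ∀ {m} (v : Vertex m) i → chainNb v i ≢ v
chainNb-irrefl (base x) i e = endpoint-irrefl x i
  (fromEndpoint-injective _ (inj₁ x) (trans (sym (chainNb-base x i)) e))
chainNb-irrefl (star i (suc l)) 1F e = prev≢ e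
chainNb-irrefl (star i (suc l)) 2F e = next≢ e

snarkDarts : ∀ m → DartGraph (Vertex m)
snarkDarts m = record
  { τ            = chainτ
  ; τ-inv        = chainτ-involutive
  ; nb-injective = chainNb-injective
  ; nb-irrefl    = chainNb-irrefl
  }

index : ∀ {m} → Vertex m → Fin (50 + (4 + m) * 4)
index {m} (base x)   = x ↑ˡ ((4 + m) * 4)
index {m} (star i l) = 50 ↑ʳ combine {4 + m} {4} i l

vertexAt : ∀ {m} → Fin (50 + (4 + m) * 4) → Vertex m
vertexAt {m} x = Sum.map₂ (remQuot {4 + m} 4) (splitAt 50 x)

vertexAt-index : ∀ {m} (v : Vertex m) → vertexAt (index v) ≡ v
vertexAt-index {m} (base x)   = cong (Sum.map₂ (remQuot {4 + m} 4)) (splitAt-↑ˡ 50 x ((4 + m) * 4))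
vertexAt-index {m} (star i l) = trans
  (cong (Sum.map₂ (remQuot {4 + m} 4)) (splitAt-↑ʳ 50 ((4 + m) * 4) (combine {4 + m} {4} i l)))
  (cong inj₂ (remQuot-combine {4 + m} {4} i l))

index-vertexAt : ∀ {m} x → index (vertexAt {m} x) ≡ x
index-vertexAt {m} x = trans (back (splitAt 50 x)) (join-splitAt 50 ((4 + m) * 4) x)
  where
  back : ∀ (v : Fin 50 ⊎ Fin ((4 + m) * 4)) → index {m} (Sum.map₂ (remQuot {4 + m} 4) v) ≡ join 50 ((4 + m) * 4) v
  back (inj₁ x) = refl
  back (inj₂ y) = cong (50 ↑ʳ_) (combine-remQuot {4 + m} 4 y)

opaque
  snarkNumbering : ∀ m → Numbering (Vertex m) (50 + (4 + m) * 4)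
  snarkNumbering m = record
    { code      = index
    ; vert      = vertexAt
    ; vert-code = vertexAt-index
    ; code-vert = index-vertexAt
    }

-- Colourings of the chain as walks between rail states

Rainbow : ∀ {k} → (Fin 3 → Fin k) → Set
Rainbow γ = γ 0F ≢ γ 1F × γ 0F ≢ γ 2F × γ 1F ≢ γ 2F

rainbow? : ∀ {k} (γ : Fin 3 → Fin k) → Dec (Rainbow γ)
rainbow? γ = distinct? (γ 0F) (γ 1F) (γ 2F)
  where
  distinct? : ∀ a b c → Dec (a ≢ b × a ≢ c × b ≢ c)
  distinct? a b c = ¬? (a ≟ᶠ b) ×-dec ¬? (a ≟ᶠ c) ×-dec ¬? (b ≟ᶠ c)

rainbow-injective : ∀ {k} (γ : Fin 3 → Fin k) → Rainbow γ → ∀ {i j} → γ i ≡ γ j → i ≡ j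
rainbow-injective γ (p , q , r) {0F} {0F} e = refl
rainbow-injective γ (p , q , r) {0F} {1F} e = ⊥-elim (p e)
rainbow-injective γ (p , q , r) {0F} {2F} e = ⊥-elim (q e)
rainbow-injective γ (p , q , r) {1F} {0F} e = ⊥-elim (p (sym e))
rainbow-injective γ (p , q , r) {1F} {1F} e = refl
rainbow-injective γ (p , q , r) {1F} {2F} e = ⊥-elim (r e)
rainbow-injective γ (p , q , r) {2F} {0F} e = ⊥-elim (q (sym e))
rainbow-injective γ (p , q , r) {2F} {1F} e = ⊥-elim (r (sym e))
rainbow-injective γ (p , q , r) {2F} {2F} e = refl

triple : ∀ {A : Set} → A → A → A → Fin 3 → A
triple a b c 0F = a
triple a b c 1F = b
triple a b c 2F = c

-- The colours of the three edges between two consecutive stars.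
State : ℕ → Set
State k = Fin 3 → Fin k

-- Which of the four vertices of a star are required to be properly coloured.
Mask : Set
Mask = Fin 4 → Bool

full : Mask
full _ = true

record StarOK {k} (μ : Mask) (s p t : State k) : Set where
  constructor starOK
  field
    centre : T (μ zero) → Rainbow p
    leaves : ∀ l → T (μ (suc l)) → Rainbow (triple (p l) (s l) (t l))
open StarOK

starOK? : ∀ {k} μ (s p t : State k) → Dec (StarOK μ s p t)
starOK? μ s p t = map′ (uncurry starOK) (λ x → centre x , leaves x)
  ((T? (μ zero) →-dec rainbow? p) ×-dec
   all? (λ l → T? (μ (suc l)) →-dec rainbow? (triple (p l) (s l) (t l))))

infixr 5 _∷_
data Chain {k} : ∀ {n} → (Fin n → Mask) → State k → State k → Set where
  []  : ∀ {M : Fin 0 → Mask} {s} → Chain M s s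
  _∷_ : ∀ {n} {M : Fin (suc n) → Mask} {s p u t} →
        StarOK (M zero) s p u → Chain (M ∘ suc) u t → Chain M s t

Walk : ∀ {k} → ℕ → State k → State k → Set
Walk n = Chain {n = n} (λ _ → full)

module _ {k : ℕ} where
  before spokes after : ∀ {n} {M : Fin n → Mask} {s t : State k} → Chain M s t → Fin n → State k
  before (_∷_ {s = s} _ _) zero    = s
  before (_ ∷ c)           (suc i) = before c i
  spokes (_∷_ {p = p} _ _) zero    = p
  spokes (_ ∷ c)           (suc i) = spokes c i
  after  (_∷_ {u = u} _ _) zero    = u
  after  (_ ∷ c)           (suc i) = after c i

  starAt : ∀ {n} {M : Fin n → Mask} {s t : State k} (c : Chain M s t) i →
           StarOK (M i) (before c i) (spokes c i) (after c i)
  starAt (x ∷ _) zero    = x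
  starAt (_ ∷ c) (suc i) = starAt c i

  before-zero : ∀ {n} {M : Fin (suc n) → Mask} {s t : State k} (c : Chain M s t) → before c zero ≡ s
  before-zero (_ ∷ _) = refl

  before-suc : ∀ {n} {M : Fin (suc n) → Mask} {s t : State k} (c : Chain M s t) (i : Fin n) →
               before c (suc i) ≡ after c (inject₁ i)
  before-suc (_ ∷ (_ ∷ _)) zero    = refl
  before-suc (_ ∷ c)       (suc i) = before-suc c i

  after-last : ∀ {n} {M : Fin (suc n) → Mask} {s t : State k} (c : Chain M s t) → after c (fromℕ n) ≡ t
  after-last (_ ∷ [])         = refl
  after-last (_ ∷ c@(_ ∷ _)) = after-last c

flip : ∀ {k} {s p t : State k} → StarOK full s p t → StarOK full t p s
flip (starOK x y) = starOK x λ l _ → let (a , b , c) = y l tt in b , a , c ∘ sym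

-- A walk may go back and forth along its first step, so its length can be
-- increased by any even number.
lengthen : ∀ {k n} {s t : State k} j → Walk (suc n) s t → Walk (suc (j * 2 + n)) s t
lengthen         zero    w = w
lengthen {k} {n} {s} {t} (suc j) w = twice (lengthen j w)
  where
  twice : Walk (suc (j * 2 + n)) s t → Walk (suc (suc (suc (j * 2 + n)))) s t
  twice (x ∷ w) = x ∷ flip x ∷ x ∷ w

single : ∀ {n} → Fin n → Mask → Fin n → Mask
single zero    μ zero    = μ
single zero    μ (suc _) = full
single (suc i) μ zero    = full
single (suc i) μ (suc j) = single i μ j

-- The exceptional stars are `inject₁ i` and `suc i`, the two ends of a rail edge.
double : ∀ {n} → Fin n → Mask → Mask → Fin (suc n) → Mask
double         zero    μ ν zero    = μ
double {suc n} zero    μ ν (suc j) = single zero ν j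
double         (suc i) μ ν zero    = full
double         (suc i) μ ν (suc j) = double i μ ν j

single-true : ∀ {n} (i j : Fin n) {μ l} → (j ≡ i → T (μ l)) → T (single i μ j l)
single-true zero    zero    h = h refl
single-true zero    (suc j) h = tt
single-true (suc i) zero    h = tt
single-true (suc i) (suc j) h = single-true i j (h ∘ cong suc)

double-true : ∀ {n} (i : Fin n) j {μ ν l} → (j ≡ inject₁ i → T (μ l)) → (j ≡ suc i → T (ν l)) →
              T (double i μ ν j l)
double-true {suc n} zero    zero    g h = g refl
double-true {suc n} zero    (suc j) g h = single-true zero j (h ∘ cong suc)
double-true {suc n} (suc i) zero    g h = tt
double-true {suc n} (suc i) (suc j) g h = double-true i j (g ∘ cong suc) (h ∘ cong suc)

module _ {k : ℕ} where
  insert : ∀ {n} (i : Fin n) {μ} {s x p y t : State k} →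
    Walk (toℕ i) s x → StarOK μ x p y → Walk (n ∸ suc (toℕ i)) y t → Chain (single i μ) s t
  insert zero    []      x w = x ∷ w
  insert (suc i) (y ∷ v) x w = y ∷ insert i v x w

  insert₂ : ∀ {n} (i : Fin n) {μ ν} {s x p y q z t : State k} →
    Walk (toℕ i) s x → StarOK μ x p y → StarOK ν y q z → Walk (n ∸ suc (toℕ i)) z t →
    Chain (double i μ ν) s t
  insert₂ {suc n} zero    []      x y w = x ∷ y ∷ w
  insert₂ {suc n} (suc i) (a ∷ v) x y w = a ∷ insert₂ i v x y w

-- The name of an edge is the least number of a dart on it.
opaque
  edgeName : Fin 50 → Fin 3 → ℕ
  edgeName x i = (3 * toℕ x + toℕ i) ⊓ nth 0 targetNumbers (3 * toℕ x + toℕ i)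

-- A dart leading into the chain is paired with no core dart, so nothing has to be matched; its
-- colour is compared with the end states of the chain instead.
SameName : Dart (Fin 50) → Target → Set
SameName d (core e)  = uncurry edgeName e ≡ uncurry edgeName d
SameName d (inj₂ _) = ⊤

sameName? : ∀ d t → Dec (SameName d t)
sameName? d (core e) = uncurry edgeName e ℕₚ.≟ uncurry edgeName d
sameName? d (inj₂ _) = yes tt

opaque
  unfolding target edgeName
  edgeName-target : ∀ x i → SameName (x , i) (target x i)
  edgeName-target = from-yes (all? λ x → all? λ i → sameName? (x , i) (target x i))

-- A colouring is packed into one number: in base k, digit e is the colour of
-- the core edge named e, and from digit 150 on follow, for each star of a
-- chain, the colours of its three spokes and then of its three edges to the right.
module Packed (b : ℕ) (L : ℕ) where
  k : ℕ
  k = suc b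

  opaque
    digit : ℕ → Fin k
    digit i = _/_ L (k ^ i) ⦃ ℕₚ.m^n≢0 k i ⦄ mod k

  β : Fin 50 → Fin 3 → Fin k
  β x i = digit (edgeName x i)

  spoke state : ℕ → State k
  spoke i l = digit (150 + 6 * i + toℕ l)
  -- The rails entering the first star are core edges and already have digits.
  state zero    l = uncurry β (leftPort l)
  state (suc i) l = digit (153 + 6 * i + toℕ l)

  RainbowExcept : Fin 50 → Fin 50 → Set
  RainbowExcept u v = ∀ x → x ≢ u → x ≢ v → Rainbow (β x)

  rainbowExcept? : ∀ u v → Dec (RainbowExcept u v)
  rainbowExcept? u v = all? λ x → ¬? (x ≟ᶠ u) →-dec ¬? (x ≟ᶠ v) →-dec rainbow? (β x)

  AllRainbow : Set
  AllRainbow = ∀ x → Rainbow (β x)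

  allRainbow? : Dec AllRainbow
  allRainbow? = all? λ x → rainbow? (β x)

  Block : Mask → ℕ → Set
  Block μ i = StarOK μ (state i) (spoke i) (state (suc i))

  block? : ∀ μ i → Dec (Block μ i)
  block? μ i = starOK? μ (state i) (spoke i) (state (suc i))

  Run : ℕ → ℕ → Set
  Run i zero    = ⊤
  Run i (suc a) = Block full i × Run (suc i) a

  run? : ∀ i a → Dec (Run i a)
  run? i zero    = yes tt
  run? i (suc a) = block? full i ×-dec run? (suc i) a

  -- This is i + a, computed along the recursion of `Run` so that the end states of walks agree
  -- definitionally.
  end : ℕ → ℕ → ℕ
  end i zero    = i
  end i (suc a) = end (suc i) a

  run-walk : ∀ i a → Run i a → Walk a (state i) (state (end i a))
  run-walk i zero    _       = []
  run-walk i (suc a) (x , r) = x ∷ run-walk (suc i) a r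

  Closes : ℕ → Set
  Closes i = ∀ l → state i l ≡ uncurry β (rightPort l)

  closes? : ∀ i → Dec (Closes i)
  closes? i = all? λ l → state i l ≟ᶠ uncurry β (rightPort l)

  -- The index `n` names the packed state in which `c` ends and is independent of the number of
  -- stars: a lengthened chain only revisits packed states, so a short literal colours arbitrarily
  -- long chains.
  module Extend {m n : ℕ} {M : Fin (4 + m) → Mask} (c : Chain M (state 0) (state n)) (closes : Closes n) where
    γ : Vertex m → Fin 3 → Fin k
    γ (base x)         i = β x i
    γ (star i zero)    l = spokes c i l
    γ (star i (suc l))   = triple (spokes c i l) (before c i l) (after c i l)

    agree-target : ∀ t {d} → Returns d t → SameName d t → uncurry γ (fromTarget t) ≡ uncurry β d
    agree-target (core e)  _    n = cong digit n
    agree-target (left l)  refl _ = cong (λ s → s l) (before-zero c)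
    agree-target (right l) refl _ = trans (cong (λ s → s l) (after-last c)) (closes l)

    agree : ∀ v i → uncurry γ (chainτ (v , i)) ≡ γ v i
    agree (base x)               i  = agree-target (target x i) (target-returns x i) (edgeName-target x i)
    agree (star i zero)          l  = refl
    agree (star i (suc l))       0F = refl
    agree (star zero (suc l))    1F = sym (cong (λ s → s l) (before-zero c))
    agree (star (suc i) (suc l)) 1F = sym (cong (λ s → s l) (before-suc c i))
    agree (star i (suc l))       2F = forth (nextView i)
      where
      forth : ∀ {i} → NextView i → uncurry γ (along (suc l) 1F (rightPort l) (next i)) ≡ after c i l
      forth last     = trans (cong (uncurry γ ∘ along (suc l) 1F (rightPort l)) (next-fromℕ (3 + m)))
                         (sym (trans (cong (λ s → s l) (after-last c)) (closes l)))
      forth (step j) = trans (cong (uncurry γ ∘ along (suc l) 1F (rightPort l)) (next-inject₁ j))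
                         (cong (λ s → s l) (before-suc c j))

    star-rainbow : ∀ i l → T (M i l) → Rainbow (γ (star i l))
    star-rainbow i zero    t = centre (starAt c i) t
    star-rainbow i (suc l) t = leaves (starAt c i) l t

-- Criticality

-- Deleting vertices is expressed by dropping properness at them: all darts keep colours that agree
-- along edges, but those at a deleted vertex may clash.
record ColouringOn {m} (k : ℕ) (P : Vertex m → Set) : Set where
  field
    γ      : Vertex m → Fin 3 → Fin k
    agree  : ∀ w i → uncurry γ (chainτ (w , i)) ≡ γ w i
    proper : ∀ w → P w → Rainbow (γ w)

Off : ∀ {m} → Vertex m → Vertex m → Vertex m → Set
Off u v w = w ≢ u × w ≢ v

NearColouring : ∀ {m} → Vertex m → Vertex m → Set
NearColouring u v = ColouringOn 3 (Off u v)

near-sym : ∀ {m} {u v : Vertex m} → NearColouring u v → NearColouring v u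
near-sym c = record { γ = γ ; agree = agree ; proper = λ w (p , q) → proper w (q , p) }
  where open ColouringOn c

colouring-from : ∀ {m} b L n {P : Vertex m → Set} {M : Fin (4 + m) → Mask} → let open Packed b L in
  (c : Chain M (state 0) (state n)) → Closes n →
  (∀ x → P (base x) → Rainbow (β x)) →
  (∀ i l → P (star i l) → T (M i l)) → ColouringOn (suc b) P
colouring-from {m} b L n {P} {M} c closes onBases onStars = record { γ = γ ; agree = agree ; proper = proper }
  where
  open Packed.Extend b L {m} {n} {M} c closes
  proper : ∀ w → P w → Rainbow (γ w)
  proper (base x)   p = onBases x p
  proper (star i l) p = star-rainbow i l (onStars i l p)

lookup : List (ℕ × ℕ) → ℕ → ℕ
lookup []             _ = 0
lookup ((a , b) ∷ xs) e = if a ≡ᵇ e then b else lookup xs e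

-- For each edge within the core, a colouring that is improper only at its ends.
coreLiterals : List (ℕ × ℕ)
coreLiterals =
  (0 , 32340819870385799018611123807832621090319737785151279956305245365368348127388) ∷
  (1 , 139867571055401897330702475866829054293693481768888425869555067619788327888895) ∷
  (2 , 56759441731440136754381653295303888216286585032718223763557066972860171030397) ∷
  (4 , 56759441731440396154924437149553004725309593758839523187927923935292305746914) ∷
  (7 , 139867571055402097764240454970620186130920068420618976427657662847814795819664) ∷
  (8 , 142468590105198816806446376414109921907248115963811106440580578406648263609065) ∷
  (10 , 33381227490304576066475381447879321520934059995409830204602699087867093008703) ∷
  (11 , 27149881425342897283910465971206296397293293970154982328603648184345325662459) ∷
  (13 , 142468590105198839949720507408046278770711728305106965752239694079614070388378) ∷
  (14 , 139867571092996599080118193946678732446734567115490445240937202044129031585018) ∷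
  (17 , 33381227490305000950548806718419495476590617879229968921731110754536732679966) ∷
  (18 , 155973291634686849386167178469321692973651577451233276147484946128874298623262) ∷
  (20 , 27149881425342896410565103068201376867904745408551202028317702969055150083586) ∷
  (22 , 176236123619741067691333823437892644790057860469774902284379352799555852747540) ∷
  (23 , 41689028126571787357667845240359488431954446237164646176912547113270972887704) ∷
  (25 , 85845552186246604933181758233993650712807360056056857381947948551788625669900) ∷
  (26 , 185066308409632153211151050612676593950612407260017579864912762190302229841104) ∷
  (27 , 169477131361498701873363929500745625878829567142053310719610113937047424609955) ∷
  (28 , 110777800302990732214515953085495954668515444921675067349929020764584626954088) ∷
  (29 , 67142594680475600471606786471602099934910572209043079418921960397325731976858) ∷
  (31 , 27149881425343238343133691300959678822062716435153691848811618141657444087640) ∷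
  (32 , 176236123619741420556136558485601236760357817431700289083846612247689047707311) ∷
  (35 , 41689028107773882546425925817772829867550491552828847078096004869603369936677) ∷
  (38 , 176236123619741067691333823437892644790057860465960212001342822464037559336943) ∷
  (39 , 54156982296150932418727196559252956223521393771750822518637629088318784974887) ∷
  (40 , 46887408973732878425754134996308950749733910743134880356804726177874577746234) ∷
  (41 , 20390889167100731884193754730980378824190977292303937922949779773538819950266) ∷
  (44 , 149739603813109155237942110330380390985888586064691723809310852398606227407397) ∷
  (47 , 89483321603530119987951086268975378753478284571719606057343015668503310806551) ∷
  (50 , 54158422681643122972735948687899443979739369825698872967161814364217929075757) ∷
  (51 , 133115281203510948833624492930456387139657105246656880000988310895171818802818) ∷
  (52 , 54156982296151404479643032938810082424191496492565353820364805888155827576363) ∷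
  (53 , 78575978845031459263237729133799626386787440240756252841546703107396754450861) ∷
  (56 , 27149881425343097280775763125525283788793461269336141733502402964995937542620) ∷
  (59 , 63511731583331605346238874540881760713018293545420888653140119403857725553569) ∷
  (62 , 63511731583331203606195527663718098434254868817275570608613857097791393194128) ∷
  (63 , 89483321603530343565405811788359327577595710303071108273003285249728784752054) ∷
  (64 , 67142594680475600471606786222617021942346199077052575187796716525092774211115) ∷
  (65 , 63511731583331605346238874540881760713018293548473077175409620679131521284065) ∷
  (68 , 64031935393291064595105409926159095396193234104641222831285769747262359374041) ∷
  (76 , 78576718822001517727663800564561315369425403753431452096930773595800798805129) ∷
  (77 , 33381227509101950303171686725061959947835410705242696728423375719894448410164) ∷
  (79 , 11560704377209999228668968772307203099918410810080312014033387426788214712570) ∷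
  (82 , 27149881425343380261643331915742605826032255840985986701125214043378245836988) ∷
  (84 , 41689028107773870739580178424890692318022986141762046103511810214642342471913) ∷
  (86 , 41689028107774083400331203689712697695309802395982274999394915648886861964844) ∷
  (88 , 41689028107773870739580178424889304547870629830362289794107093361561052523515) ∷
  (91 , 41689028107774436701674298598867988912984754874254753059176685379348379750161) ∷
  (92 , 41689028107774094752932648348329577674687639444068819280175668324547530014778) ∷
  (93 , 41689028107774236267626026623682239196810967616134971036671237928918947113221) ∷
  (94 , 41689028107774437574887340374051056765205856242236294603094422770855976907844) ∷
  (95 , 41689028107773882529742571355107160881149377264957720693082251522051053433928) ∷
  (98 , 41689028107774437574887340871906213102361478759928744092148463944368205399056) ∷
  (101 , 41689028107774437575019661002354706543552531660609670596631568225576427326499) ∷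
  (104 , 41689028107774236704809000193613227481676845207353106715048587502374871340981) ∷
  (105 , 41689028107774095626655985201416375380822621866468762626932497893189413834725) ∷
  (106 , 41689028107774236704298710120605460869201888848968701217266070370998374040197) ∷
  (107 , 41689028107774437574887342166022938140703344884250626017334613645571091049535) ∷
  (110 , 41689028107774437573999167482941775392364424176156229921828880766449830846665) ∷
  (113 , 41689028107774437574133861345989692438800559075435172529448566575766306659699) ∷
  (116 , 41689028107774236705121207403854981097581442431516661942263316185113688792417) ∷
  (117 , 41689028107774236703967634030776849520845480725085031826820916016599790352911) ∷
  (118 , 41689028107774095626789948685299368601561817613321780305429546087328238739451) ∷
  (119 , 41689028107774236268048368944190621578605696905463965249196832947642208110771) ∷
  (122 , 41689028107774366832891700091294477511171554506391706447591772927740903025730) ∷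
  (125 , 41689028107774095626412798333695152726376083160727660042628912981696656260419) ∷
  (128 , 41689028107773883403910433166293690579721436814387082611693962103341527360017) ∷
  (129 , 41689028107774578167716170404296656171125521244434241023815095987936615770879) ∷
  (130 , 41689028107774613521208575955630342741738700657983147555879316832077830946757) ∷
  (131 , 41689028107774602168474809457971157864801171919089417346415014741183351288255) ∷
  (141 , 107143691183312373946233960713649937596962230834638723384906322419151542493843) ∷
  (145 , 183503519662464856230948278479869684225403492156223824956525848895875061999970) ∷ []

coreLiteral : Fin 50 → Fin 3 → ℕ
coreLiteral x i = lookup coreLiterals (edgeName x i)

-- Both deleted vertices lie in the core, so the chain is coloured throughout; its number of stars
-- being even, two packed stars can be lengthened to all of it. Edges between core and chain have
-- literals of their own.
CoreOK : Fin 50 → Target → ℕ → Set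
CoreOK x (core (y , _)) L = RainbowExcept x y × Run 0 2 × Closes 2
  where open Packed 2 L
CoreOK x (inj₂ _)       L = ⊤

coreOK? : ∀ x t L → Dec (CoreOK x t L)
coreOK? x (core (y , _)) L = rainbowExcept? x y ×-dec run? 0 2 ×-dec closes? 2
  where open Packed 2 L
coreOK? x (inj₂ _)       L = yes tt

opaque
  unfolding Packed.digit target edgeName

  coreLiteral-OK : ∀ x i → CoreOK x (target x i) (coreLiteral x i)
  coreLiteral-OK = from-yes (all? λ x → all? λ i → coreOK? x (target x i) (coreLiteral x i))

leftLiterals rightLiterals : List ℕ
leftLiterals =
  90067171805578003640968280911886226386448993761809192380561915863110618784898202299 ∷
  47553558249494383498256051535860111374243949376570160661385052794040399414390143600 ∷
  70466548959425248741354692152900171234179428561038780061009348364250549685778530624 ∷ []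
rightLiterals =
  47547877882511578014987405288607713168561202030850845095845788584193134102893966484 ∷
  93982827575530961193206196061993470694865455946480990387901546828541602568193597838 ∷
  35864913874311737669761000988171032728068178390958002070416447559566813501882809724 ∷ []

-- Indexed by the leaf, then by the residue classes of the numbers of stars on
-- either side: 1 or 2 (before), 0, 1 or 2 (after), the last two standing for
-- all longer walks of the same parity.
spokeLiterals railLiterals : List ℕ
spokeLiterals =
  61971839508615147030914120592230917758974481985134432401013591754814458307650 ∷
  54249959809796816363484808662299574626754752878672708574903743659665342332556390 ∷
  94486132047521026733501451656732534024184930962244533494487536394475260244887367507 ∷
  24728121034744576495724898259249655595710124861480934228112509560505242406181153 ∷
  94487831293636247561150002930016099931362686177252693375189377391893489584070549807 ∷
  47346550528560393821069425653697924986711986206263187804848072299468083839419547276767 ∷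
  62819483127830964437821256582582070860996667983118288723805098493906944860029 ∷
  54251038696219178793737857089781203774169200634237669449060450743692997600017034 ∷
  94485375748138950669894064709067911991847403085596457255521193194989432456463614623 ∷
  24756172081725999682304157373772013428485766506060081465095242452927035981102911 ∷
  94487058810957836061088820255939253461813941584271206089740159516241773897178385663 ∷
  47347380884594552081023634788259634136579049752136525223808806352467900671489571401174 ∷
  18135439362326621000386588876256829147906011927670857795987653304195244725332 ∷
  54247802036952091502978711807336316331925857367555460152485476382064854136010356 ∷
  94486134898652292414189905014476763596959271063206245097692772614286287500159374301 ∷
  57789516439962359416173437122654400006704226934562982929608355286631433947814607 ∷
  93656506149749100553966067618321576682634112607482842914239179201009403860763064447 ∷
  47346549152171040492199030327166565298327172224539031195344703808260175073654808899104 ∷ []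
railLiterals =
  25086041605363312732173714076280125250453167768755245607690764096059263532543520 ∷
  93656372907275938793829816137527595482928428309671091964863511033910260163373145073 ∷
  47346550921814494772175252889849742040536218772470089693277606154098914915352329670385 ∷
  83439393168117255034359045518337104039390870802527284129476948119991791997452122005 ∷
  47346545612884131932246585201800211813909079128676914199478899116582695390259767356542 ∷
  43757647898016407565221104499217043366832205796335789273715329618165011440790383540423392 ∷
  54206534631296728545799609456164001443323230717357291621155091287501276811886069 ∷
  94487288767681009033345540307668365970119022937778452711921737024914094660957097139 ∷
  47347381053170555575153361827076428141133333259598331588876336297011295337098617351799 ∷
  93982846789814075869090723651212805063314659243311647949260547773566492521394970267 ∷
  47346534995023406252389249825701151360654799841090563211881485041550256340074642728856 ∷
  43757646528239645316016153326632456135555873758889414978971655357522976004766337810145968 ∷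
  85928056242835069293506601971042063050892843192084268324989447549463396054654077 ∷
  93657962800334499609420503732097301531549421059062646859822657163056027328447349431 ∷
  47346550921814494772175252889849742040536218772470089693277606154098914915352329670385 ∷
  95638099538918232105815746994898535811618841365276349761714172572790592972571882457 ∷
  47346455361067963653459234504958197961247705184192930804900879478806963463686208021211 ∷
  43757648556349222585303885536494783582955693517533153773629776775293873936404947322395638 ∷ []

firstSpokeLiterals firstRailLiterals : List ℕ
firstSpokeLiterals =
  94485374361422108758238170187289379362888380674695276994839487335678281385511177371 ∷
  82337732318041843405760501457596493912639180585691341465048832609424946849009666678 ∷
  94486130740721697589432983286689370404792383695621542917985992879243940719112552039 ∷ []
firstRailLiterals =
  93659031158364531880100410614293465233484161844344838602057359355894449959793259887 ∷
  82892544219321073751778264486449875453416392832340164287946537930031350568230865635 ∷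
  94485376704929172970732416692344135411934924951815894863344803481056304566784586537 ∷ []

nthᶠ : List ℕ → ∀ {n} → Fin n → ℕ
nthᶠ xs = nth 0 xs ∘ toℕ

except-true : ∀ {m} (i : Fin (4 + m)) (a b l : Fin 4) →
  inj₂ (i , l) ≢ (Vertex m ∋ star i a) → inj₂ (i , l) ≢ (Vertex m ∋ star i b) → T (others a b l)
except-true i a b l p q = others-true {u = a} {b} {l} (λ e → p (cong (λ x → inj₂ (i , x)) e)) (λ e → q (cong (λ x → inj₂ (i , x)) e))

-- An empty walk has no step to retrace. Hence the lengths that stand for the longer walks of either
-- parity are 1 and 2, and 0 stands only for itself.
data Grows : ℕ → ℕ → Set where
  same : ∀ {n} → Grows n n
  more : ∀ {n} j → Grows (suc n) (suc (j * 2 + n))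

grow : ∀ {k a n} {s t : State k} → Grows a n → Walk a s t → Walk n s t
grow same     w = w
grow (more j) w = lengthen j w

grows-suc² : ∀ {a n} → Grows (suc a) n → Grows (suc a) (suc (suc n))
grows-suc² same     = more 1
grows-suc² (more j) = more (suc j)

classify⁺ : ∀ n → ∃ λ (c : Fin 2) → Grows (suc (toℕ c)) (suc n)
classify⁺ zero          = 0F , same
classify⁺ (suc zero)    = 1F , same
classify⁺ (suc (suc n)) = proj₁ (classify⁺ n) , grows-suc² (proj₂ (classify⁺ n))

classify : ∀ n → ∃ λ (c : Fin 3) → Grows (toℕ c) n
classify zero    = 0F , same
classify (suc n) = suc (proj₁ (classify⁺ n)) , proj₂ (classify⁺ n)

module _ (L : ℕ) where
  open Packed 2 L

  SpokeOK : Fin 3 → ℕ → ℕ → Set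
  SpokeOK l a b = AllRainbow × Run 0 a × Block (others 0F (suc l)) (end 0 a) ×
                  Run (suc (end 0 a)) b × Closes (end (suc (end 0 a)) b)

  spokeOK? : ∀ l a b → Dec (SpokeOK l a b)
  spokeOK? l a b = allRainbow? ×-dec run? 0 a ×-dec block? (others 0F (suc l)) (end 0 a) ×-dec
                   run? (suc (end 0 a)) b ×-dec closes? (end (suc (end 0 a)) b)

  -- A rail edge joins equally placed leaves of successive stars, so each of the two stars is exempt
  -- at a single vertex, expressed by `others` with equal arguments.
  RailOK : Fin 3 → ℕ → ℕ → Set
  RailOK l a b = AllRainbow × Run 0 a × Block (others (suc l) (suc l)) (end 0 a) ×
                 Block (others (suc l) (suc l)) (suc (end 0 a)) ×
                 Run (suc (suc (end 0 a))) b × Closes (end (suc (suc (end 0 a))) b)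

  railOK? : ∀ l a b → Dec (RailOK l a b)
  railOK? l a b = allRainbow? ×-dec run? 0 a ×-dec block? (others (suc l) (suc l)) (end 0 a) ×-dec
                  block? (others (suc l) (suc l)) (suc (end 0 a)) ×-dec
                  run? (suc (suc (end 0 a))) b ×-dec closes? (end (suc (suc (end 0 a))) b)

  spoke-near : ∀ {m} (i : Fin (4 + m)) l {a b} → SpokeOK l a b →
    Grows a (toℕ i) → Grows b (3 + m ∸ toℕ i) → NearColouring {m} (star i 0F) (star i (suc l))
  spoke-near {m} i l {a} {b} (bases , pre , mid , post , closes) g h =
    colouring-from 2 L (end (suc (end 0 a)) b) (insert i (grow g (run-walk 0 a pre)) mid (grow h (run-walk _ b post))) closes
      (λ x _ → bases x)
      (λ j k (p , q) → single-true i j λ { refl → except-true i 0F (suc l) k p q })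

  rail-near : ∀ {m} (i : Fin (3 + m)) l {a b} → RailOK l a b →
    Grows a (toℕ i) → Grows b (2 + m ∸ toℕ i) →
    NearColouring {m} (star (suc i) (suc l)) (star (inject₁ i) (suc l))
  rail-near {m} i l {a} {b} (bases , pre , mid₁ , mid₂ , post , closes) g h =
    colouring-from 2 L (end (suc (suc (end 0 a))) b) (insert₂ i (grow g (run-walk 0 a pre)) mid₁ mid₂ (grow h (run-walk _ b post))) closes
      (λ x _ → bases x)
      (λ j k (p , q) → double-true i j
        (λ { refl → except-true (inject₁ i) (suc l) (suc l) k q q })
        (λ { refl → except-true (suc i) (suc l) (suc l) k p p }))

  -- The exempt first star is kept outside the walk that is lengthened, since retracing needs fully
  -- proper stars; the other three have the parity of 3 + m.
  LeftOK : Fin 3 → Set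
  LeftOK l = (∀ x → x ≢ proj₁ (leftPort l) → Rainbow (β x)) ×
             Block (others (suc l) (suc l)) 0 × Run 1 3 × Closes 4

  leftOK? : ∀ l → Dec (LeftOK l)
  leftOK? l = (all? λ x → ¬? (x ≟ᶠ proj₁ (leftPort l)) →-dec rainbow? (β x)) ×-dec
              block? (others (suc l) (suc l)) 0 ×-dec run? 1 3 ×-dec closes? 4

  RightOK : Fin 3 → Set
  RightOK l = (∀ x → x ≢ proj₁ (rightPort l) → Rainbow (β x)) ×
              Run 0 3 × Block (others (suc l) (suc l)) 3 × Closes 4

  rightOK? : ∀ l → Dec (RightOK l)
  rightOK? l = (all? λ x → ¬? (x ≟ᶠ proj₁ (rightPort l)) →-dec rainbow? (β x)) ×-dec
               run? 0 3 ×-dec block? (others (suc l) (suc l)) 3 ×-dec closes? 4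

spokeLiteral : Fin 3 → Fin 2 → Fin 3 → ℕ
spokeLiteral l c d = nth 0 spokeLiterals (6 * toℕ l + (3 * toℕ c + toℕ d))

railLiteral : Fin 3 → Fin 2 → Fin 3 → ℕ
railLiteral l c d = nth 0 railLiterals (6 * toℕ l + (3 * toℕ c + toℕ d))

opaque
  unfolding Packed.digit edgeName

  spokeLiteral-OK : ∀ l c d → SpokeOK (spokeLiteral l c d) l (suc (toℕ c)) (toℕ d)
  spokeLiteral-OK = from-yes (all? λ l → all? λ c → all? λ d → spokeOK? (spokeLiteral l c d) l (suc (toℕ c)) (toℕ d))

  railLiteral-OK : ∀ l c d → RailOK (railLiteral l c d) l (suc (toℕ c)) (toℕ d)
  railLiteral-OK = from-yes (all? λ l → all? λ c → all? λ d → railOK? (railLiteral l c d) l (suc (toℕ c)) (toℕ d))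

  firstSpoke-OK : ∀ l → SpokeOK (nthᶠ firstSpokeLiterals l) l 0 3
  firstSpoke-OK = from-yes (all? λ l → spokeOK? (nthᶠ firstSpokeLiterals l) l 0 3)

  firstRail-OK : ∀ l → RailOK (nthᶠ firstRailLiterals l) l 0 2
  firstRail-OK = from-yes (all? λ l → railOK? (nthᶠ firstRailLiterals l) l 0 2)

  leftLiteral-OK : ∀ l → LeftOK (nthᶠ leftLiterals l) l
  leftLiteral-OK = from-yes (all? λ l → leftOK? (nthᶠ leftLiterals l) l)

  rightLiteral-OK : ∀ l → RightOK (nthᶠ rightLiterals l) l
  rightLiteral-OK = from-yes (all? λ l → rightOK? (nthᶠ rightLiterals l) l)

fourLiteral : ℕ
fourLiteral = 6822004584304050341762615869542241119107482190201015321325299127237654696730574377997238411559719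

opaque
  unfolding Packed.digit edgeName

  fourLiteral-OK : let open Packed 3 fourLiteral in AllRainbow × Run 0 2 × Closes 2
  fourLiteral-OK = from-yes (allRainbow? ×-dec run? 0 2 ×-dec closes? 2)
    where open Packed 3 fourLiteral

module Even (j : ℕ) where
  m : ℕ
  m = j * 2

  grows : ∀ a → Grows (suc a) (suc a + m)
  grows a = subst (Grows (suc a) ∘ suc) (ℕₚ.+-comm m a) (more j)

  grows₂ : Grows 2 (4 + m)
  grows₂ = subst (Grows 2 ∘ suc) (trans (ℕₚ.+-comm (2 + m) 1) refl) (more (suc j))

  clean-colouring : ∀ {b} L {P : Vertex m → Set} → let open Packed b L in
    (∀ x → P (base x) → Rainbow (β x)) → Run 0 2 → Closes 2 → ColouringOn (suc b) P
  clean-colouring {b} L bases walk closes =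
    colouring-from b L 2 (grow grows₂ (run-walk 0 2 walk)) closes bases (λ _ _ _ → tt)
    where open Packed b L

  four-colouring : ColouringOn {m} 4 (λ _ → ⊤)
  four-colouring with fourLiteral-OK
  ... | bases , walk , closes = clean-colouring fourLiteral (λ x _ → bases x) walk closes

  core-near : ∀ x t L → CoreOK x t L → ∀ {y i} → t ≡ core (y , i) → NearColouring {m} (base x) (base y)
  core-near x _ L (bases , walk , closes) refl =
    clean-colouring L (λ z (p , q) → bases z (p ∘ cong inj₁) (q ∘ cong inj₁)) walk closes

  left-near : ∀ l → NearColouring {m} (star zero (suc l)) (base (proj₁ (leftPort l)))
  left-near l with leftLiteral-OK l
  ... | bases , first , post , closes =
    colouring-from 2 (nthᶠ leftLiterals l) 4 (insert zero [] first (grow (grows 2) (run-walk 1 3 post))) closes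
      (λ x (_ , q) → bases x (q ∘ cong inj₁))
      (λ i k (p , _) → single-true zero i λ { refl → except-true zero (suc l) (suc l) k p p })
    where open Packed 2 (nthᶠ leftLiterals l)

  right-near : ∀ l → NearColouring {m} (star (fromℕ (3 + m)) (suc l)) (base (proj₁ (rightPort l)))
  right-near l with rightLiteral-OK l
  ... | bases , pre , final , closes =
    colouring-from 2 (nthᶠ rightLiterals l) 4 (insert (fromℕ (3 + m))
        (subst (λ n → Walk n (state 0) (state 3)) (sym (toℕ-fromℕ (3 + m))) (grow (grows 2) (run-walk 0 3 pre)))
        final
        (subst (λ n → Walk n (state 4) (state 4)) (sym (trans (cong (3 + m ∸_) (toℕ-fromℕ (3 + m))) (ℕₚ.n∸n≡0 (3 + m)))) []))
      closes
      (λ x (_ , q) → bases x (q ∘ cong inj₁))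
      (λ i k (p , _) → single-true (fromℕ (3 + m)) i λ { refl → except-true (fromℕ (3 + m)) (suc l) (suc l) k p p })
    where open Packed 2 (nthᶠ rightLiterals l)

  star-spoke : ∀ i l → NearColouring {m} (star i 0F) (star i (suc l))
  -- No star precedes the first one, so the walk before it is empty and this case needs its own
  -- literals, with three stars after it.
  star-spoke zero    l = spoke-near (nthᶠ firstSpokeLiterals l) zero l (firstSpoke-OK l) same (grows 2)
  star-spoke (suc i) l with classify⁺ (toℕ i) | classify (2 + m ∸ toℕ i)
  ... | c , g | d , h = spoke-near (spokeLiteral l c d) (suc i) l (spokeLiteral-OK l c d) g h

  star-rail : ∀ i l → NearColouring {m} (star (suc i) (suc l)) (star (inject₁ i) (suc l))
  star-rail zero    l = rail-near (nthᶠ firstRailLiterals l) zero l (firstRail-OK l) same (grows 1)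
  star-rail (suc i) l with classify⁺ (toℕ i) | classify (1 + m ∸ toℕ i)
  ... | c , g | d , h = rail-near (railLiteral l c d) (suc i) l (railLiteral-OK l c d) g h

  near-target : ∀ x i t → Returns (x , i) t → CoreOK x t (coreLiteral x i) →
    NearColouring {m} (base x) (proj₁ (fromTarget t))
  near-target x i (core (y , j)) _    c = core-near x (core (y , j)) (coreLiteral x i) c refl
  near-target x i (left l)       refl _ = near-sym (left-near l)
  near-target x i (right l)      refl _ = near-sym (right-near l)

  near : ∀ (v : Vertex m) i → NearColouring {m} v (chainNb v i)
  near (base x)               i  = near-target x i (target x i) (target-returns x i) (coreLiteral-OK x i)
  near (star i zero)          l  = star-spoke i l
  near (star i (suc l))       0F = near-sym (star-spoke i l)
  near (star zero (suc l))    1F = left-near l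
  near (star (suc i) (suc l)) 1F = star-rail i l
  near (star i (suc l))       2F = forth (nextView i)
    where
    forth : ∀ {i} → NextView i → NearColouring {m} (star i (suc l)) (proj₁ (along (suc l) 1F (rightPort l) (next i)))
    forth last     = subst (λ n → NearColouring {m} (star (fromℕ (3 + m)) (suc l)) (proj₁ (along (suc l) 1F (rightPort l) n)))
                       (sym (next-fromℕ (3 + m))) (right-near l)
    forth (step j) = subst (λ n → NearColouring {m} (star (inject₁ j) (suc l)) (proj₁ (along (suc l) 1F (rightPort l) n)))
                       (sym (next-inject₁ j)) (near-sym (star-rail j l))

-- Uncolourability

-- For distinct colours this is -(a + b) modulo three; on equal ones the value is arbitrary.
third : Fin 3 → Fin 3 → Fin 3
third 0F 1F = 2F
third 0F 2F = 1F
third 0F 0F = 0F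
third 1F 0F = 2F
third 1F 2F = 0F
third 1F 1F = 0F
third 2F 0F = 1F
third 2F 1F = 0F
third 2F 2F = 0F

triple? : ∀ (a b c : Fin 3) → Dec (Rainbow (triple a b c))
triple? a b c = rainbow? (triple a b c)

third-rainbow : ∀ a b → a ≢ b → Rainbow (triple a (third a b) b)
third-rainbow = from-yes (all? λ a → all? λ b → ¬? (a ≟ᶠ b) →-dec triple? a (third a b) b)

rainbow-third : ∀ a b c → Rainbow (triple a b c) → b ≡ third a c
rainbow-third = from-yes (all? λ a → all? λ b → all? λ c → triple? a b c →-dec (b ≟ᶠ third a c))

Shifted : (a b c a′ b′ c′ : Fin 3) → Set
Shifted a b c a′ b′ c′ = a ≡ a′ × b ≡ b′ × c ≡ c′ ⊎ a ≡ b′ × b ≡ c′ × c ≡ a′ ⊎ a ≡ c′ × b ≡ a′ × c ≡ b′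

shifted? : ∀ a b c a′ b′ c′ → Dec (Shifted a b c a′ b′ c′)
shifted? a b c a′ b′ c′ = (a ≟ᶠ a′ ×-dec b ≟ᶠ b′ ×-dec c ≟ᶠ c′) ⊎-dec
  (a ≟ᶠ b′ ×-dec b ≟ᶠ c′ ×-dec c ≟ᶠ a′) ⊎-dec (a ≟ᶠ c′ ×-dec b ≟ᶠ a′ ×-dec c ≟ᶠ b′)

CyclicShift : State 3 → State 3 → Set
CyclicShift s t = Shifted (s 0F) (s 1F) (s 2F) (t 0F) (t 1F) (t 2F)

shifted-trans : ∀ {a b c d e f g h i} → Shifted a b c d e f → Shifted d e f g h i → Shifted a b c g h i
shifted-trans (inj₁ (refl , refl , refl))        q                                  = q
shifted-trans p                                  (inj₁ (refl , refl , refl))        = p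
shifted-trans (inj₂ (inj₁ (refl , refl , refl))) (inj₂ (inj₁ (refl , refl , refl))) = inj₂ (inj₂ (refl , refl , refl))
shifted-trans (inj₂ (inj₁ (refl , refl , refl))) (inj₂ (inj₂ (refl , refl , refl))) = inj₁ (refl , refl , refl)
shifted-trans (inj₂ (inj₂ (refl , refl , refl))) (inj₂ (inj₁ (refl , refl , refl))) = inj₁ (refl , refl , refl)
shifted-trans (inj₂ (inj₂ (refl , refl , refl))) (inj₂ (inj₂ (refl , refl , refl))) = inj₂ (inj₁ (refl , refl , refl))

-- If `u` is constant, no rainbow triple avoids it in every place. Otherwise exactly two do, and
-- completing either of them and `u` to all three colours on each rail gives two states that are
-- cyclic shifts of each other.
two-steps : ∀ p₀ p₁ p₂ → Rainbow (triple p₀ p₁ p₂) → ∀ u₀ u₁ u₂ → p₀ ≢ u₀ × p₁ ≢ u₁ × p₂ ≢ u₂ →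
  ∀ q₀ q₁ q₂ → Rainbow (triple q₀ q₁ q₂) → q₀ ≢ u₀ × q₁ ≢ u₁ × q₂ ≢ u₂ →
  Shifted (third p₀ u₀) (third p₁ u₁) (third p₂ u₂) (third q₀ u₀) (third q₁ u₁) (third q₂ u₂)
two-steps = from-yes
  (all? λ p₀ → all? λ p₁ → all? λ p₂ → triple? p₀ p₁ p₂ →-dec
   all? λ u₀ → all? λ u₁ → all? λ u₂ → differ? p₀ p₁ p₂ u₀ u₁ u₂ →-dec
   all? λ q₀ → all? λ q₁ → all? λ q₂ → triple? q₀ q₁ q₂ →-dec differ? q₀ q₁ q₂ u₀ u₁ u₂ →-dec
   shifted? (third p₀ u₀) (third p₁ u₁) (third p₂ u₂) (third q₀ u₀) (third q₁ u₁) (third q₂ u₂))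
  where
  differ? : ∀ (a b c d e f : Fin 3) → Dec (a ≢ d × b ≢ e × c ≢ f)
  differ? a b c d e f = ¬? (a ≟ᶠ d) ×-dec ¬? (b ≟ᶠ e) ×-dec ¬? (c ≟ᶠ f)

rainbow-swap : ∀ {a b c : Fin 3} → Rainbow (triple a b c) → Rainbow (triple a c b)
rainbow-swap (i , j , k) = j , i , k ∘ sym

star-star-shift : ∀ {s p u q t : State 3} → StarOK full s p u → StarOK full u q t → CyclicShift s t
star-star-shift {s} {p} {u} {q} {t} (starOK x f) (starOK y g)
  -- Both outer states are determined by the spokes and the middle state, and are eliminated in
  -- favour of `third`.
  rewrite rainbow-third (p 0F) (s 0F) (u 0F) (f 0F tt)
        | rainbow-third (p 1F) (s 1F) (u 1F) (f 1F tt)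
        | rainbow-third (p 2F) (s 2F) (u 2F) (f 2F tt)
        | rainbow-third (q 0F) (t 0F) (u 0F) (rainbow-swap {q 0F} {u 0F} {t 0F} (g 0F tt))
        | rainbow-third (q 1F) (t 1F) (u 1F) (rainbow-swap {q 1F} {u 1F} {t 1F} (g 1F tt))
        | rainbow-third (q 2F) (t 2F) (u 2F) (rainbow-swap {q 2F} {u 2F} {t 2F} (g 2F tt))
  = two-steps (p 0F) (p 1F) (p 2F) (x tt) (u 0F) (u 1F) (u 2F) (outer f)
              (q 0F) (q 1F) (q 2F) (y tt) (proj₁ (g 0F tt) , proj₁ (g 1F tt) , proj₁ (g 2F tt))
  where
  outer : (∀ l → ⊤ → Rainbow (triple (p l) (s l) (u l))) → p 0F ≢ u 0F × p 1F ≢ u 1F × p 2F ≢ u 2F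
  outer f = proj₁ (proj₂ (f 0F tt)) , proj₁ (proj₂ (f 1F tt)) , proj₁ (proj₂ (f 2F tt))

even-walk-shift : ∀ j {s t : State 3} → Walk (j * 2) s t → CyclicShift s t
even-walk-shift zero    []          = inj₁ (refl , refl , refl)
even-walk-shift (suc j) (x ∷ y ∷ w) = shifted-trans (star-star-shift x y) (even-walk-shift j w)

-- Here `b` and `z` are the colours on the two halves of the severed edge, `x` and `y` those of the
-- bridge edges at `t`. Suppose b = z. Without a shift, both bridge leaves see the same two rail
-- colours, so x = y. The two proper shifts give b = c′ and c = b′ respectively, a clash at one of
-- the bridge leaves.
bridge-check : ∀ a b c a′ b′ c′ → Shifted a b c a′ b′ c′ → ∀ x y z → x ≢ y →
  Rainbow (triple x z c′) → Rainbow (triple y c b′) → b ≢ z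
bridge-check = from-yes
  (all? λ a → all? λ b → all? λ c → all? λ a′ → all? λ b′ → all? λ c′ → shifted? a b c a′ b′ c′ →-dec
   all? λ x → all? λ y → all? λ z → ¬? (x ≟ᶠ y) →-dec triple? x z c′ →-dec triple? y c b′ →-dec ¬? (b ≟ᶠ z))

-- Read colours modulo three. A spoke is minus the sum of its two rims, so even and odd spokes have
-- the same sum, and the differences across the three opposite pairs, taken as even minus odd, add
-- up to zero. If none vanished they would all be equal; then exactly one pair of opposite rims
-- shares a colour, and this forces two consecutive rims to agree.
hexagon-check : ∀ a b → a ≢ b → ∀ c → b ≢ c → ∀ d → c ≢ d → ∀ e → d ≢ e → ∀ f → e ≢ f → f ≢ a →
  ¬ (third f a ≢ third c d × third b c ≢ third e f × third d e ≢ third a b)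
hexagon-check = from-yes
  (all? λ a → all? λ b → ¬? (a ≟ᶠ b) →-dec all? λ c → ¬? (b ≟ᶠ c) →-dec all? λ d → ¬? (c ≟ᶠ d) →-dec
   all? λ e → ¬? (d ≟ᶠ e) →-dec all? λ f → ¬? (e ≟ᶠ f) →-dec ¬? (f ≟ᶠ a) →-dec
   ¬? (¬? (third f a ≟ᶠ third c d) ×-dec ¬? (third b c ≟ᶠ third e f) ×-dec ¬? (third d e ≟ᶠ third a b)))

walk-along : ∀ {n} (B : Fin (suc n) → State 3) (P : Fin n → State 3) →
  (∀ i → StarOK full (B (inject₁ i)) (P i) (B (suc i))) → Walk n (B zero) (B (fromℕ n))
walk-along {zero}  B P ok = []
walk-along {suc n} B P ok = ok zero ∷ walk-along (B ∘ suc) (P ∘ suc) (ok ∘ suc)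

-- The second pole copies the first with vertex numbers shifted by 22, and is attached to the
-- hexagon at 2 and 5 instead of 0 and 3.
vᵖ : Fin 2 → Fin 4 → Fin 4 → Fin 50
vᵖ p i l = (9 + 22 * toℕ p + (4 * toℕ i + toℕ l)) mod 50

bᵖ tᵖ cᵖ hᵖ h′ᵖ : Fin 2 → Fin 50
bᵖ p  = (6 + 22 * toℕ p) mod 50
tᵖ p  = (7 + 22 * toℕ p) mod 50
cᵖ p  = (8 + 22 * toℕ p) mod 50
hᵖ p  = (2 * toℕ p) mod 50
h′ᵖ p = (3 + 2 * toℕ p) mod 50

opaque
  unfolding target
  spokeᵖ : ∀ p i l → target (vᵖ p i zero) l ≡ core (vᵖ p i (suc l) , 0F)
  spokeᵖ = from-yes (all? λ p → all? λ i → all? λ l → target (vᵖ p i zero) l ≟ᵗ core (vᵖ p i (suc l) , 0F))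

opaque
  unfolding target
  railᵖ : ∀ p i l → target (vᵖ p (suc i) (suc l)) 1F ≡ core (vᵖ p (inject₁ i) (suc l) , 2F)
  railᵖ = from-yes (all? λ p → all? λ i → all? λ l →
    target (vᵖ p (suc i) (suc l)) 1F ≟ᵗ core (vᵖ p (inject₁ i) (suc l) , 2F))

leads : ∀ {m} (d e : Fin 2 → Dart (Fin 50)) {_ : True (all? λ p → uncurry target (d p) ≟ᵗ core (e p))} →
  ∀ p → chainτ {m} (onBase (d p)) ≡ onBase (e p)
leads _ _ {ok} p = cong fromTarget (toWitness ok p)

-- Hub 25 is joined to the three vertices `t`, hub 26 to the entries of the three first rails. These
-- two are deleted; hub 27, which takes the exits of the first rails, stays.
OffHubs : Fin 50 → Set
OffHubs x = x ≢ 25 mod 50 × x ≢ 26 mod 50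

offHubs? : ∀ x → Dec (OffHubs x)
offHubs? x = ¬? (x ≟ᶠ 25 mod 50) ×-dec ¬? (x ≟ᶠ 26 mod 50)

starOff : ∀ p i l → OffHubs (vᵖ p i l)
starOff = from-yes (all? λ p → all? λ i → all? λ l → offHubs? (vᵖ p i l))

hex : Fin 6 → Fin 50
hex i = toℕ i mod 50

before′ : Fin 6 → Fin 6
before′ 0F      = 5F
before′ (suc i) = inject₁ i

opaque
  unfolding target
  hex-back : ∀ i → target (hex i) 0F ≡ core (hex (before′ i) , 1F)
  hex-back = from-yes (all? λ i → target (hex i) 0F ≟ᵗ core (hex (before′ i) , 1F))

hex-off : ∀ i → OffHubs (hex i)
hex-off = from-yes (all? λ i → offHubs? (hex i))

opaque
  unfolding target
  hex-nb-off : ∀ i j → endpoint (target (hex i) j) ≢ inj₁ (25 mod 50) × endpoint (target (hex i) j) ≢ inj₁ (26 mod 50)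
  hex-nb-off = from-yes (all? λ i → all? λ j →
    ¬? (endpoint (target (hex i) j) ≟ᵉ inj₁ (25 mod 50)) ×-dec ¬? (endpoint (target (hex i) j) ≟ᵉ inj₁ (26 mod 50)))

-- Poles and hexagon after the removal of two hubs

module Removed {m : ℕ} where
  open Realise (snarkDarts m) (snarkNumbering m) public
  open Numbering (snarkNumbering m) public

  hub : Fin 3 → Vertex m
  hub i = base ((25 + toℕ i) mod 50)

  module Uncolourable (C : RemovalColourable graph (code (hub 0F)) (code (hub 1F))) where
    open Colouring C

    off-hubs : ∀ {v} → v ≢ hub 0F → v ≢ hub 1F → Kept v
    off-hubs p q = kept (others-true (p ∘ code-injective) (q ∘ code-injective))

    rainbow : ∀ v → Kept v → (∀ i → Kept (chainNb v i)) → Rainbow (colour v)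
    rainbow v k ks = colour-≢ v k (ks 0F) (ks 1F) (λ ()) , colour-≢ v k (ks 0F) (ks 2F) (λ ())
                   , colour-≢ v k (ks 1F) (ks 2F) (λ ())

    -- Stars v 0, …, v n joined in a row and closed by a bridge b – t – c, as in
    -- a pole; h and h′ are the hexagon vertices to which the pole is attached.
    record Pole (n : ℕ) (h h′ : Vertex m) : Set where
      field
        v           : Fin (suc n) → Fin 4 → Vertex m
        b t c       : Vertex m
        spoke       : ∀ i l → chainτ (v i zero , l) ≡ (v i (suc l) , 0F)
        rail        : ∀ i l → chainτ (v (suc i) (suc l) , 1F) ≡ (v (inject₁ i) (suc l) , 2F)
        b-t         : chainτ (b , 0F) ≡ (t , 0F)
        c-t         : chainτ (c , 0F) ≡ (t , 1F)
        b-h         : chainτ (b , 1F) ≡ (h , 2F)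
        h′-v        : chainτ (v zero 2F , 1F) ≡ (h′ , 2F)
        v-c         : chainτ (v zero 3F , 1F) ≡ (c , 1F)
        c-v         : chainτ (v (fromℕ n) 2F , 2F) ≡ (c , 2F)
        b-v         : chainτ (v (fromℕ n) 3F , 2F) ≡ (b , 2F)
        v-kept      : ∀ i l → Kept (v i l)
        b-kept      : Kept b
        t-kept      : Kept t
        c-kept      : Kept c
        h-kept      : Kept h
        h′-kept     : Kept h′
        exit-kept   : Kept (chainNb (v (fromℕ n) 1F) 2F)

    module _ {n h h′} (P : Pole n h h′) where
      open Pole P

      out : Fin (suc n) → State 3
      out i l = colour (v i (suc l)) 2F

      spokes′ : Fin (suc n) → State 3
      spokes′ i l = colour (v i zero) l

      -- The first rail may come from a deleted hub, where the given colouring says nothing; its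
      -- colour is therefore defined to be the one missing at the leaf.
      entry : State 3
      entry = triple (third (spokes′ zero 0F) (out zero 0F)) (colour (v zero 2F) 1F) (colour (v zero 3F) 1F)

      boundary : Fin (suc (suc n)) → State 3
      boundary zero    = entry
      boundary (suc i) = out i

      kept-τ : ∀ w i {x j} → chainτ (w , i) ≡ (x , j) → Kept x → Kept (chainNb w i)
      kept-τ w i e = subst Kept (sym (cong proj₁ e))

      next-kept : ∀ i l → Kept (chainNb (v i (suc l)) 2F)
      next-kept i l with nextView i
      ... | step j = kept-τ (v (inject₁ j) (suc l)) 2F back (v-kept (suc j) (suc l))
        where
        back : chainτ (v (inject₁ j) (suc l) , 2F) ≡ (v (suc j) (suc l) , 1F)
        back = trans (cong chainτ (sym (rail j l))) (chainτ-involutive _)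
      next-kept i 0F | last = exit-kept
      next-kept i 1F | last = kept-τ (v (fromℕ n) 2F) 2F c-v c-kept
      next-kept i 2F | last = kept-τ (v (fromℕ n) 3F) 2F b-v b-kept

      centre-kept : ∀ i l → Kept (chainNb (v i (suc l)) 0F)
      centre-kept i l = kept-τ (v i (suc l)) 0F (trans (cong chainτ (sym (spoke i l))) (chainτ-involutive _)) (v-kept i zero)

      spoke-colour : ∀ i l → colour (v i (suc l)) 0F ≡ spokes′ i l
      spoke-colour i l = sym (colour-τ (v i zero) l (spoke i l) (v-kept i zero) (v-kept i (suc l)))

      centre-rainbow : ∀ i → Rainbow (spokes′ i)
      centre-rainbow i = rainbow (v i zero) (v-kept i zero) (λ l → kept-τ (v i zero) l (spoke i l) (v-kept i (suc l)))

      leaf : ∀ i l → Kept (chainNb (v i (suc l)) 1F) →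
             Rainbow (triple (spokes′ i l) (colour (v i (suc l)) 1F) (out i l))
      leaf i l k = subst (λ a → Rainbow (triple a (colour (v i (suc l)) 1F) (out i l))) (spoke-colour i l)
        (rainbow (v i (suc l)) (v-kept i (suc l)) λ { 0F → centre-kept i l ; 1F → k ; 2F → next-kept i l })

      entry-leaf : ∀ l → Rainbow (triple (spokes′ zero l) (entry l) (out zero l))
      entry-leaf 0F = third-rainbow _ _ (subst (_≢ out zero 0F) (spoke-colour zero 0F)
        (colour-≢ (v zero 1F) (v-kept zero 1F) (centre-kept zero 0F) (next-kept zero 0F) (λ ())))
      entry-leaf 1F = leaf zero 1F (kept-τ (v zero 2F) 1F h′-v h′-kept)
      entry-leaf 2F = leaf zero 2F (kept-τ (v zero 3F) 1F v-c c-kept)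

      star-ok : ∀ i → StarOK full (boundary (inject₁ i)) (spokes′ i) (boundary (suc i))
      star-ok zero    = starOK (λ _ → centre-rainbow zero) (λ l _ → entry-leaf l)
      star-ok (suc i) = starOK (λ _ → centre-rainbow (suc i)) (λ l _ →
        subst (λ a → Rainbow (triple (spokes′ (suc i) l) a (out (suc i) l)))
          (colour-τ (v (suc i) (suc l)) 1F (rail i l) (v-kept (suc i) (suc l)) (v-kept (inject₁ i) (suc l)))
          (leaf (suc i) l (kept-τ (v (suc i) (suc l)) 1F (rail i l) (v-kept (inject₁ i) (suc l)))))

      pole-colours : ∀ j → suc n ≡ j * 2 → colour h 2F ≢ colour h′ 2F
      pole-colours j even e = bridge-check _ _ _ _ _ _
        (even-walk-shift j (subst (λ k → Walk k entry (out (fromℕ n))) even (walk-along boundary spokes′ star-ok)))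
        (colour b 0F) (colour c 0F) (colour b 1F)
        -- The two bridge edges meet at `t`. Only these two neighbours of `t` have to be kept; the
        -- third is a deleted hub.
        (λ q → colour-≢ t {0F} {1F} t-kept (nb-kept t 0F b-t b-kept) (nb-kept t 1F c-t c-kept) (λ ())
                 (trans (sym (colour-τ b 0F b-t b-kept t-kept)) (trans q (colour-τ c 0F c-t c-kept t-kept))))
        (subst (λ a → Rainbow (triple (colour b 0F) (colour b 1F) a)) (sym (colour-τ (v (fromℕ n) 3F) 2F b-v (v-kept _ _) b-kept))
          (rainbow b b-kept λ { 0F → kept-τ b 0F b-t t-kept ; 1F → kept-τ b 1F b-h h-kept ; 2F → nb-kept b 2F b-v (v-kept _ _) }))
        (subst₂ (λ a d → Rainbow (triple (colour c 0F) a d))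
          (sym (colour-τ (v zero 3F) 1F v-c (v-kept _ _) c-kept)) (sym (colour-τ (v (fromℕ n) 2F) 2F c-v (v-kept _ _) c-kept))
          (rainbow c c-kept λ { 0F → kept-τ c 0F c-t t-kept ; 1F → nb-kept c 1F v-c (v-kept _ _) ; 2F → nb-kept c 2F c-v (v-kept _ _) }))
        (trans (colour-τ (v zero 2F) 1F h′-v (v-kept _ _) h′-kept) (trans (sym e) (sym (colour-τ b 1F b-h b-kept h-kept))))
        where
        nb-kept : ∀ {w i} x j → chainτ (w , i) ≡ (x , j) → Kept w → Kept (chainNb x j)
        nb-kept {w} {i} x j e = kept-τ x j (trans (cong chainτ (sym e)) (chainτ-involutive (w , i)))

    base-kept : ∀ x → OffHubs x → Kept (base x)
    base-kept x (p , q) = off-hubs (p ∘ inj₁-injective) (q ∘ inj₁-injective)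

    star-kept : ∀ i l → Kept (star i l)
    star-kept i l = off-hubs (λ ()) (λ ())

    opaque
      unfolding target
      chain-pole : Pole (3 + m) (base (4 mod 50)) (base (1 mod 50))
      chain-pole = record
        { v         = star
        ; b = base (47 mod 50) ; t = base (48 mod 50) ; c = base (49 mod 50)
        ; spoke     = λ i l → refl
        ; rail      = λ i l → refl
        ; b-t = refl ; c-t = refl ; b-h = refl ; h′-v = refl ; v-c = refl
        ; c-v       = cong (along 2F 1F (rightPort 1F)) (next-fromℕ (3 + m))
        ; b-v       = cong (along 3F 1F (rightPort 2F)) (next-fromℕ (3 + m))
        ; v-kept    = star-kept
        ; b-kept    = base-kept (47 mod 50) ((λ ()) , λ ())
        ; t-kept    = base-kept (48 mod 50) ((λ ()) , λ ())
        ; c-kept    = base-kept (49 mod 50) ((λ ()) , λ ())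
        ; h-kept    = base-kept (4 mod 50) ((λ ()) , λ ())
        ; h′-kept   = base-kept (1 mod 50) ((λ ()) , λ ())
        ; exit-kept = subst (λ n → Kept (proj₁ (along 1F 1F (rightPort 0F) n))) (sym (next-fromℕ (3 + m)))
                        (base-kept (27 mod 50) ((λ ()) , λ ()))
        }

    keptᵖ : (x : Fin 2 → Fin 50) {_ : True (all? λ p → offHubs? (x p))} → ∀ p → Kept (base (x p))
    keptᵖ x {ok} p = base-kept (x p) (toWitness ok p)

    opaque
      unfolding target
      core-pole : (p : Fin 2) → Pole 3 (base (hᵖ p)) (base (h′ᵖ p))
      core-pole p = record
        { v         = λ i l → base (vᵖ p i l)
        ; b = base (bᵖ p) ; t = base (tᵖ p) ; c = base (cᵖ p)
        ; spoke     = λ i l → cong fromTarget (spokeᵖ p i l)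
        ; rail      = λ i l → cong fromTarget (railᵖ p i l)
        ; b-t       = leads (λ p → bᵖ p , 0F) (λ p → tᵖ p , 0F) p
        ; c-t       = leads (λ p → cᵖ p , 0F) (λ p → tᵖ p , 1F) p
        ; b-h       = leads (λ p → bᵖ p , 1F) (λ p → hᵖ p , 2F) p
        ; h′-v      = leads (λ p → vᵖ p 0F 2F , 1F) (λ p → h′ᵖ p , 2F) p
        ; v-c       = leads (λ p → vᵖ p 0F 3F , 1F) (λ p → cᵖ p , 1F) p
        ; c-v       = leads (λ p → vᵖ p 3F 2F , 2F) (λ p → cᵖ p , 2F) p
        ; b-v       = leads (λ p → vᵖ p 3F 3F , 2F) (λ p → bᵖ p , 2F) p
        ; v-kept    = λ i l → base-kept (vᵖ p i l) (starOff p i l)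
        ; b-kept    = keptᵖ bᵖ p
        ; t-kept    = keptᵖ tᵖ p
        ; c-kept    = keptᵖ cᵖ p
        ; h-kept    = keptᵖ hᵖ p
        ; h′-kept   = keptᵖ h′ᵖ p
        ; exit-kept = subst Kept
            (sym (cong proj₁ (leads (λ p → vᵖ p 3F 1F , 2F) (λ p → 27 mod 50 , toℕ p mod 3) p)))
            (keptᵖ (λ _ → 27 mod 50) p)
        }

    spokeOf rimOf : Fin 6 → Fin 3
    spokeOf i = colour (base (hex i)) 2F
    rimOf i   = colour (base (hex i)) 1F

    hex-kept : ∀ i → Kept (base (hex i))
    hex-kept i = base-kept (hex i) (hex-off i)

    hex-nb-kept : ∀ i j → Kept (chainNb (base (hex i)) j)
    hex-nb-kept i j = off-hubs (away (25 mod 50) (proj₁ (hex-nb-off i j))) (away (26 mod 50) (proj₂ (hex-nb-off i j)))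
      where
      away : ∀ x → endpoint (target (hex i) j) ≢ inj₁ x → chainNb {m} (base (hex i)) j ≢ base x
      away x ne e = ne (fromEndpoint-injective _ (inj₁ x) (trans (sym (chainNb-base (hex i) j)) e))

    hex-rainbow : ∀ i → Rainbow (triple (rimOf (before′ i)) (rimOf i) (spokeOf i))
    hex-rainbow i = subst (λ a → Rainbow (triple a (rimOf i) (spokeOf i)))
      (colour-τ (base (hex i)) 0F (cong fromTarget (hex-back i)) (hex-kept i) (hex-kept (before′ i)))
      (rainbow (base (hex i)) (hex-kept i) (hex-nb-kept i))

    rims≢ : ∀ i → rimOf (before′ i) ≢ rimOf i
    rims≢ i = proj₁ (hex-rainbow i)

    spoke≡ : ∀ i → spokeOf i ≡ third (rimOf (before′ i)) (rimOf i)
    spoke≡ i = rainbow-third _ _ _ (rainbow-swap {rimOf (before′ i)} {rimOf i} {spokeOf i} (hex-rainbow i))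

    uncolourable : ∀ k → m ≡ k * 2 → ⊥
    uncolourable k even = hexagon-check
      (rimOf 0F) (rimOf 1F) (rims≢ 1F) (rimOf 2F) (rims≢ 2F) (rimOf 3F) (rims≢ 3F)
      (rimOf 4F) (rims≢ 4F) (rimOf 5F) (rims≢ 5F) (rims≢ 0F)
      ( subst₂ _≢_ (spoke≡ 0F) (spoke≡ 3F) (pole-colours (core-pole 0F) 2 refl)
      , subst₂ _≢_ (spoke≡ 2F) (spoke≡ 5F) (pole-colours (core-pole 1F) 2 refl)
      , subst₂ _≢_ (spoke≡ 4F) (spoke≡ 1F) (pole-colours chain-pole (2 + k) (cong (4 +_) even)) )

  removal-uncolourable : ∀ k → m ≡ k * 2 → ¬ RemovalColourable graph (code (hub 0F)) (code (hub 1F))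
  removal-uncolourable k even C = Uncolourable.uncolourable C k even

  -- A colouring of the whole graph restricts to the graph without two hubs, so one argument yields
  -- both the chromatic index and the failure of bicriticality.
  not-3-colourable : ∀ k → m ≡ k * 2 → ∀ j → j < 4 → ¬ EdgeColourable j graph
  not-3-colourable k even j (s≤s j≤3) (c , symmetric , distinct) = removal-uncolourable k even
    ( (λ x y → inject≤ (c x y) j≤3)
    , (λ x y _ _ a → cong (λ i → inject≤ i j≤3) (symmetric x y tt tt a))
    , (λ x y z _ _ _ a b y≢z e → distinct x y z tt tt tt a b y≢z (inject≤-injective j≤3 j≤3 _ _ e)) )

-- Connectedness and girth

Below : ℕ → Target → Set
Below n (core (y , _)) = toℕ y < n
Below n (inj₂ _)       = ⊥

below? : ∀ n t → Dec (Below n t)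
below? n (core (y , _)) = toℕ y <? n
below? n (inj₂ _)       = no λ ()

Below² : ℕ → Target → Set
Below² n (core (y , _)) = ∃ λ j → Below n (target y j)
Below² n (inj₂ _)       = ⊥

below²? : ∀ n t → Dec (Below² n t)
below²? n (core (y , _)) = any? λ j → below? n (target y j)
below²? n (inj₂ _)       = no λ ()

opaque
  unfolding target
  -- A vertex may precede all its neighbours, as the star centres within the core do; hence two
  -- steps are allowed before the number has to drop.
  descend : ∀ x → x ≡ zero ⊎ ∃ λ i → Below (toℕ x) (target x i) ⊎ Below² (toℕ x) (target x i)
  descend = from-yes (all? λ x → (x ≟ᶠ zero) ⊎-dec
    any? λ i → below? (toℕ x) (target x i) ⊎-dec below²? (toℕ x) (target x i))

module Shape (m : ℕ) where
  open DartGraph (snarkDarts m) public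

  base-root : ∀ x → Acc _<_ (toℕ x) → Star Link (base x) (base zero)
  base-root x (acc rec) = from (descend x)
    where
    lower : ∀ t → Below (toℕ x) t → Star Link (proj₁ (fromTarget t)) (base zero)
    lower (core (y , _)) y<x = base-root y (rec y<x)
    lower² : ∀ t → Below² (toℕ x) t → Star Link (proj₁ (fromTarget t)) (base zero)
    lower² (core (y , _)) (j , z<x) = link (base y) j ◅ lower (target y j) z<x
    from : _ → Star Link (base x) (base zero)
    from (inj₁ refl)           = ε
    from (inj₂ (i , inj₁ b))  = link (base x) i ◅ lower (target x i) b
    from (inj₂ (i , inj₂ b))  = link (base x) i ◅ lower² (target x i) b

  leaf-root : ∀ i → Star Link (star i 3F) (base zero)
  leaf-root = <-weakInduction (λ i → Star Link (star i 3F) (base zero))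
    (link (star zero 3F) 1F ◅ base-root _ (<-wellFounded _))
    (λ i r → link (star (suc i) 3F) 1F ◅ r)

  root : ∀ v → Star Link v (base zero)
  root (base x)         = base-root x (<-wellFounded _)
  root (star i zero)    = link (star i zero) 2F ◅ leaf-root i
  root (star i (suc l)) = link (star i (suc l)) 0F ◅ link (star i zero) 2F ◅ leaf-root i

-- Only turning back is excluded, so these walks are preserved by locally injective maps.
data Short {V : Set} (E : V → V → Set) : V → Set where
  three : ∀ {a b c} → E a b → E b c → E c a → c ≢ a → a ≢ b → b ≢ c → Short E a
  four  : ∀ {a b c d} → E a b → E b c → E c d → E d a → c ≢ a → d ≢ b → Short E a
  five  : ∀ {a b c d e} → E a b → E b c → E c d → E d e → E e a →
          c ≢ a → d ≢ b → e ≢ c → a ≢ d → b ≢ e → Short E a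

module ShortCycles {V : Set} {n : ℕ} (D : DartGraph V) (N : Numbering V n) where
  open DartGraph D
  open Numbering N
  open Realise D N

  no-short-cycle : (∀ a → ¬ Short Link a) → ∀ ℓ → ℓ < 6 → ¬ HasCycleOfLength graph ℓ
  no-short-cycle not-short ℓ ℓ<6 (record { m = k ; vtx = w ; inj = inj ; edges = edges ; close = close } , refl) = go k ℓ<6 w inj edges close
    where
    apart : ∀ {k} {w : Fin k → Fin n} → (∀ {i j} → w i ≡ w j → i ≡ j) → ∀ {i j} → i ≢ j → vert (w i) ≢ vert (w j)
    apart inj i≢j e = i≢j (inj (vert-injective e))
    go : ∀ k → 3 + k < 6 → (w : Fin (3 + k) → Fin n) → (∀ {i j} → w i ≡ w j → i ≡ j) →
         (∀ i → Adj graph (w (inject₁ i)) (w (suc i))) → Adj graph (w (fromℕ (2 + k))) (w zero) → ⊥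
    go 0 _ w inj es cl = not-short _ (three (adj⇒link (es 0F)) (adj⇒link (es 1F)) (adj⇒link cl)
      (apart inj (λ ())) (apart inj (λ ())) (apart inj (λ ())))
    go 1 _ w inj es cl = not-short _ (four (adj⇒link (es 0F)) (adj⇒link (es 1F)) (adj⇒link (es 2F)) (adj⇒link cl)
      (apart inj (λ ())) (apart inj (λ ())))
    go 2 _ w inj es cl = not-short _ (five (adj⇒link (es 0F)) (adj⇒link (es 1F)) (adj⇒link (es 2F)) (adj⇒link (es 3F)) (adj⇒link cl)
      (apart inj (λ ())) (apart inj (λ ())) (apart inj (λ ())) (apart inj (λ ())) (apart inj (λ ())))
    go (suc (suc (suc k))) (s≤s (s≤s (s≤s (s≤s (s≤s (s≤s ())))))) w inj es cl

module Search {V : Set} (_≟_ : DecidableEquality V) (nb : V → Fin 3 → V) where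
  -- One tree of walks that never turn back serves all three lengths: after three, four and five
  -- steps the walk must not be at `a`.
  NoShort : V → Set
  NoShort a = ∀ i → let b = nb a i in ∀ j → let c = nb b j in c ≢ a →
              ∀ k → let d = nb c k in d ≢ a × (d ≢ b →
              ∀ l → let e = nb d l in e ≢ a × (e ≢ c → ∀ n → nb e n ≢ a))

  noShort? : ∀ a → Dec (NoShort a)
  noShort? a = all? λ i → at₁ (nb a i)
    where
    at₄ : ∀ c e → Dec (e ≢ a × (e ≢ c → ∀ n → nb e n ≢ a))
    at₄ c e = ¬? (e ≟ a) ×-dec (¬? (e ≟ c) →-dec all? λ n → ¬? (nb e n ≟ a))
    at₃ : ∀ b c d → Dec (d ≢ a × (d ≢ b → ∀ l → nb d l ≢ a × (nb d l ≢ c → ∀ n → nb (nb d l) n ≢ a)))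
    at₃ b c d = ¬? (d ≟ a) ×-dec (¬? (d ≟ b) →-dec all? λ l → at₄ c (nb d l))
    at₂ : ∀ b c → Dec (c ≢ a → ∀ k → _)
    at₂ b c = ¬? (c ≟ a) →-dec all? λ k → at₃ b c (nb c k)
    at₁ : ∀ b → Dec (∀ j → _)
    at₁ b = all? λ j → at₂ b (nb b j)

  noShort : ∀ a → NoShort a → ¬ Short (λ u v → ∃ λ i → nb u i ≡ v) a
  noShort _ h (three (i , refl) (j , refl) (k , e) p _ _) = proj₁ (h i j p k) e
  noShort _ h (four (i , refl) (j , refl) (k , refl) (l , e) p q) = proj₁ (proj₂ (h i j p k) q l) e
  noShort _ h (five (i , refl) (j , refl) (k , refl) (l , refl) (n , e) p q r _ _) =
    proj₂ (proj₂ (h i j p k) q l) r n e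

_≟⁰_ : DecidableEquality (Vertex 0)
_≟⁰_ = ⊎-≡-dec _≟ᶠ_ (×-≡-dec _≟ᶠ_ _≟ᶠ_)

opaque
  unfolding target
  base-noShort : ∀ x → Search.NoShort _≟⁰_ chainNb (base x)
  base-noShort = from-yes (all? λ x → Search.noShort? _≟⁰_ chainNb (base x))

-- Short cycles: through the core, and within the chain

squeeze : ∀ {m} → Fin (5 + m) → Fin (4 + m)
squeeze zero          = zero
squeeze (suc zero)    = suc zero
squeeze (suc (suc i)) = suc i

-- Star 2 is laid onto star 1 and the later stars move up. Off star 2 the map is injective and
-- preserves links, so it carries closed walks that avoid star 2 to a shorter chain without creating
-- backtracking.
collapse : ∀ {m} → Vertex (suc m) → Vertex m
collapse (base x)   = base x
collapse (star i l) = star (squeeze i) l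

OffThird : ∀ {m} → Vertex (suc m) → Set
OffThird v = ∀ l → v ≢ star 2F l

collapse-nb : ∀ {m} (u : Vertex (suc m)) i → OffThird u → OffThird (chainNb u i) →
              collapse (chainNb u i) ≡ chainNb (collapse u) i
collapse-nb (base x) i _ _ = onTarget (target x i)
  where
  onTarget : ∀ {m} t → collapse {m} (proj₁ (fromTarget t)) ≡ proj₁ (fromTarget t)
  onTarget (core _)  = refl
  onTarget (left _)  = refl
  onTarget (right _) = refl
collapse-nb (star i zero)    _  _ _ = refl
collapse-nb (star i (suc l)) 0F _ _ = refl
collapse-nb (star 0F (suc l)) 1F _ _ = refl
collapse-nb (star 1F (suc l)) 1F _ _ = refl
collapse-nb (star 2F (suc l)) 1F p _ = ⊥-elim (p _ refl)
collapse-nb (star 3F (suc l)) 1F _ q = ⊥-elim (q _ refl)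
collapse-nb (star (suc (suc (suc (suc i)))) (suc l)) 1F _ _ = refl
collapse-nb (star 0F (suc l)) 2F _ _ = refl
collapse-nb (star 1F (suc l)) 2F _ q = ⊥-elim (q _ refl)
collapse-nb (star 2F (suc l)) 2F p _ = ⊥-elim (p _ refl)
collapse-nb {m} (star (suc (suc (suc i))) (suc l)) 2F _ _ = onNext (next i)
  where
  onNext : ∀ n → collapse {m} (proj₁ (along (suc l) 1F (rightPort l) (Maybe.map suc (Maybe.map suc (Maybe.map suc n)))))
               ≡ proj₁ (along (suc l) 1F (rightPort l) (Maybe.map suc (Maybe.map suc n)))
  onNext (just _) = refl
  onNext nothing  = refl

squeeze-injective : ∀ {m} (i j : Fin (5 + m)) → i ≢ 2F → j ≢ 2F → squeeze i ≡ squeeze j → i ≡ j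
squeeze-injective 0F 0F _ _ _ = refl
squeeze-injective 0F 1F _ _ ()
squeeze-injective 0F (suc (suc _)) _ _ ()
squeeze-injective 1F 1F _ _ _ = refl
squeeze-injective 1F 2F _ q _ = ⊥-elim (q refl)
squeeze-injective 2F _  p _ _ = ⊥-elim (p refl)
squeeze-injective (suc (suc (suc i))) 2F _ q _ = ⊥-elim (q refl)
squeeze-injective (suc (suc (suc i))) (suc (suc (suc j))) _ _ refl = refl

collapse-injective : ∀ {m} {u v : Vertex (suc m)} → OffThird u → OffThird v → collapse u ≡ collapse v → u ≡ v
collapse-injective {u = base _}   {base _}   _ _ refl = refl
collapse-injective {u = star i l} {star j k} p q e =
  cong₂ (λ i l → inj₂ (i , l))
    (squeeze-injective i j (λ { refl → p l refl }) (λ { refl → q k refl }) (cong proj₁ (inj₂-injective e)))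
    (cong proj₂ (inj₂-injective e))

data OnStar {m} : Vertex m → Set where
  onStar : ∀ i l → OnStar (star i l)

third-nb : ∀ {m} l i → OnStar (chainNb {suc m} (star 2F l) i)
third-nb zero    i  = onStar _ _
third-nb (suc l) 0F = onStar _ _
third-nb (suc l) 1F = onStar _ _
third-nb (suc l) 2F = onStar _ _

-- Among at least five stars, star 2 has two further stars on either side, so the core is more than
-- two steps away.
third-nb² : ∀ {m} l i j → OnStar (chainNb {suc m} (chainNb (star 2F l) i) j)
third-nb² zero    i  0F = onStar _ _
third-nb² zero    i  1F = onStar _ _
third-nb² zero    i  2F = onStar _ _
third-nb² (suc l) 0F j  = onStar _ _
third-nb² (suc l) 1F 0F = onStar _ _
third-nb² (suc l) 1F 1F = onStar _ _
third-nb² (suc l) 1F 2F = onStar _ _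
third-nb² (suc l) 2F 0F = onStar _ _
third-nb² (suc l) 2F 1F = onStar _ _
third-nb² (suc l) 2F 2F = onStar _ _

base-off : ∀ {m x} → OffThird {m} (base x)
base-off l ()

base-not-onStar : ∀ {m x} → ¬ OnStar {m} (base x)
base-not-onStar ()

module _ (m : ℕ) where
  private
    module G = DartGraph (snarkDarts (suc m))
    module G′ = DartGraph (snarkDarts m)

  off₁ : ∀ {x b} → G.Link (base x) b → OffThird b
  off₁ {x} p l refl = base-not-onStar {suc m} {x} (subst OnStar (proj₂ q) (third-nb {m} l (proj₁ q)))
    where
    q = G.link-sym {base x} p

  off₂ : ∀ {x b c} → G.Link (base x) b → G.Link b c → OffThird c
  off₂ {x} {b} p q l refl = base-not-onStar {suc m} {x} (subst OnStar
    (trans (cong (λ b → chainNb b (proj₁ r)) (proj₂ t)) (proj₂ r)) (third-nb² {m} l (proj₁ t) (proj₁ r)))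
    where
    r = G.link-sym {base x} p
    t = G.link-sym {b} q

  collapse-link : ∀ {u v} → OffThird u → OffThird v → G.Link u v → G′.Link (collapse u) (collapse v)
  collapse-link {u} p q (i , refl) = i , sym (collapse-nb u i p q)

  -- Followed from its core vertex in both directions, a closed walk of length at most five stays
  -- within two steps of the core and thus avoids star 2.
  collapse-short : ∀ {x} → Short G.Link (base x) → Short G′.Link (base x)
  collapse-short (three {b = b} {c} ab bc ca c≢a a≢b b≢c) =
    three (collapse-link a! b! ab) (collapse-link b! c! bc) (collapse-link c! a! ca)
      (c≢a ∘ collapse-injective c! a!) (a≢b ∘ collapse-injective a! b!) (b≢c ∘ collapse-injective b! c!)
    where
    a! = base-off {m}
    b! = off₁ ab
    c! = off₂ ab bc
  collapse-short (four {b = b} {c} {d} ab bc cd da c≢a d≢b) =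
    four (collapse-link a! b! ab) (collapse-link b! c! bc) (collapse-link c! d! cd) (collapse-link d! a! da)
      (c≢a ∘ collapse-injective c! a!) (d≢b ∘ collapse-injective d! b!)
    where
    a! = base-off {m}
    b! = off₁ ab
    c! = off₂ ab bc
    d! = off₁ (G.link-sym {d} da)
  collapse-short (five {b = b} {c} {d} {e} ab bc cd de ea c≢a d≢b e≢c a≢d b≢e) =
    five (collapse-link a! b! ab) (collapse-link b! c! bc) (collapse-link c! d! cd) (collapse-link d! e! de)
      (collapse-link e! a! ea)
      (c≢a ∘ collapse-injective c! a!) (d≢b ∘ collapse-injective d! b!) (e≢c ∘ collapse-injective e! c!)
      (a≢d ∘ collapse-injective a! d!) (b≢e ∘ collapse-injective b! e!)
    where
    a! = base-off {m}
    b! = off₁ ab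
    c! = off₂ ab bc
    e! = off₁ (G.link-sym {e} ea)
    d! = off₂ (G.link-sym {e} ea) (G.link-sym {d} de)

base-not-short : ∀ m {x} → ¬ Short (DartGraph.Link (snarkDarts m)) (base x)
base-not-short zero    {x} = Search.noShort _≟⁰_ (chainNb {0}) (base x) (base-noShort x)
base-not-short (suc m)     = base-not-short m ∘ collapse-short m

-- A closed walk that stays on the chain is mapped to a ring of six stars.
Ring : Set
Ring = Fin 6 × Fin 4

up down : Fin 6 → Fin 6
up 0F = 1F
up 1F = 2F
up 2F = 3F
up 3F = 4F
up 4F = 5F
up 5F = 0F
down 0F = 5F
down 1F = 0F
down 2F = 1F
down 3F = 2F
down 4F = 3F
down 5F = 4F

down-up : ∀ i → down (up i) ≡ i
down-up = from-yes (all? λ i → down (up i) ≟ᶠ i)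

ringNb : Ring → Fin 3 → Ring
ringNb (i , zero)  l  = i , suc l
ringNb (i , suc l) 0F = i , zero
ringNb (i , suc l) 1F = down i , suc l
ringNb (i , suc l) 2F = up i , suc l

_≟ʳ_ : DecidableEquality Ring
_≟ʳ_ = ×-≡-dec _≟ᶠ_ _≟ᶠ_

-- Six stars are the fewest possible: in a ring of five, a rail would itself be a cycle of length
-- five.
ring-noShort : ∀ i l → Search.NoShort _≟ʳ_ ringNb (i , l)
ring-noShort = from-yes (all? λ i → all? λ l → Search.noShort? _≟ʳ_ ringNb (i , l))

ringNb-injective : ∀ i l j k → ringNb (i , l) j ≡ ringNb (i , l) k → j ≡ k
ringNb-injective = from-yes (all? λ i → all? λ l → all? λ j → all? λ k →
  (ringNb (i , l) j ≟ʳ ringNb (i , l) k) →-dec (j ≟ᶠ k))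

wind : ∀ {n} → Fin n → Fin 6
wind zero    = 0F
wind (suc i) = up (wind i)

wind-inject₁ : ∀ {n} (i : Fin n) → wind (inject₁ i) ≡ wind i
wind-inject₁ zero    = refl
wind-inject₁ (suc i) = cong up (wind-inject₁ i)

ringOf : ∀ {m} → Vertex m → Ring
ringOf (base _)   = 0F , 0F
ringOf (star i l) = wind i , l

module _ {m : ℕ} where
  open DartGraph (snarkDarts m)

  ring-nb : ∀ i l k → OnStar (chainNb {m} (star i l) k) → ringOf (chainNb {m} (star i l) k) ≡ ringNb (wind i , l) k
  ring-nb i       zero    k  _ = refl
  ring-nb i       (suc l) 0F _ = refl
  ring-nb (suc i) (suc l) 1F _ = cong (_, suc l) (trans (wind-inject₁ i) (sym (down-up (wind i))))
  ring-nb i       (suc l) 2F s = forth (nextView i) s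
    where
    forth : ∀ {i} → NextView i → OnStar (proj₁ (along {m} (suc l) 1F (rightPort l) (next i))) →
            ringOf (proj₁ (along {m} (suc l) 1F (rightPort l) (next i))) ≡ (up (wind i) , suc l)
    forth last s with subst (OnStar ∘ proj₁ ∘ along (suc l) 1F (rightPort l)) (next-fromℕ (3 + m)) s
    ... | ()
    forth (step j) _ = trans (cong (ringOf ∘ proj₁ ∘ along {m} (suc l) 1F (rightPort l)) (next-inject₁ j))
                         (cong (λ k → up k , suc l) (sym (wind-inject₁ j)))

  RingLink : Ring → Ring → Set
  RingLink u v = ∃ λ i → ringNb u i ≡ v

  ring-link : ∀ {u v} → OnStar u → OnStar v → Link u v → RingLink (ringOf u) (ringOf v)
  ring-link (onStar i l) s (k , refl) = k , sym (ring-nb i l k s)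

  ring-≢ : ∀ {u v w} → OnStar u → OnStar v → OnStar w → Link u v → Link u w → v ≢ w → ringOf v ≢ ringOf w
  ring-≢ (onStar i l) s t (j , refl) (k , refl) v≢w e = v≢w (cong (chainNb (star i l))
    (ringNb-injective (wind i) l j k (trans (sym (ring-nb i l j s)) (trans e (ring-nb i l k t)))))

  not-base : ∀ {v : Vertex m} → Short Link v → OnStar v
  not-base {base x}   s = ⊥-elim (base-not-short m s)
  not-base {star i l} s = onStar i l

  -- A closed walk can be rotated to start at any of its vertices. Since none can start in the core,
  -- all its vertices lie on the chain, and its image in the ring still never turns back.
  not-short : ∀ a → ¬ Short Link a
  not-short a s@(three {b = b} {c} ab bc ca c≢a a≢b b≢c) = not-ring (ringOf a) (three
      (ring-link a! b! ab) (ring-link b! c! bc) (ring-link c! a! ca)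
      (ring-≢ b! c! a! bc (link-sym ab) c≢a)
      (ring-≢ c! a! b! ca (link-sym bc) a≢b)
      (ring-≢ a! b! c! ab (link-sym ca) b≢c))
    where
    a! = not-base s
    b! = not-base (three bc ca ab a≢b b≢c c≢a)
    c! = not-base (three ca ab bc b≢c c≢a a≢b)
    not-ring : ∀ r → ¬ Short RingLink r
    not-ring (i , l) = Search.noShort _≟ʳ_ ringNb (i , l) (ring-noShort i l)
  not-short a s@(four ab bc cd da c≢a d≢b) = Search.noShort _≟ʳ_ ringNb (ringOf a) (ring-noShort _ _) (four
      (ring-link a! b! ab) (ring-link b! c! bc) (ring-link c! d! cd) (ring-link d! a! da)
      (ring-≢ b! c! a! bc (link-sym ab) c≢a)
      (ring-≢ c! d! b! cd (link-sym bc) d≢b))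
    where
    a! = not-base s
    b! = not-base (four bc cd da ab d≢b (c≢a ∘ sym))
    c! = not-base (four cd da ab bc (c≢a ∘ sym) (d≢b ∘ sym))
    d! = not-base (four da ab bc cd (d≢b ∘ sym) c≢a)
  not-short a s@(five ab bc cd de ea c≢a d≢b e≢c a≢d b≢e) = Search.noShort _≟ʳ_ ringNb (ringOf a) (ring-noShort _ _) (five
      (ring-link a! b! ab) (ring-link b! c! bc) (ring-link c! d! cd) (ring-link d! e! de) (ring-link e! a! ea)
      (ring-≢ b! c! a! bc (link-sym ab) c≢a)
      (ring-≢ c! d! b! cd (link-sym bc) d≢b)
      (ring-≢ d! e! c! de (link-sym cd) e≢c)
      (ring-≢ e! a! d! ea (link-sym de) a≢d)
      (ring-≢ a! b! e! ab (link-sym ea) b≢e))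
    where
    a! = not-base s
    b! = not-base (five bc cd de ea ab d≢b e≢c a≢d b≢e c≢a)
    c! = not-base (five cd de ea ab bc e≢c a≢d b≢e c≢a d≢b)
    d! = not-base (five de ea ab bc cd a≢d b≢e c≢a d≢b e≢c)
    e! = not-base (five ea ab bc cd de b≢e c≢a d≢b e≢c a≢d)

opaque
  unfolding target
  hex-forth : ∀ (i : Fin 5) → target (hex (inject₁ i)) 1F ≡ core (hex (suc i) , 0F)
  hex-forth = from-yes (all? λ i → target (hex (inject₁ i)) 1F ≟ᵗ core (hex (suc i) , 0F))

hex-injective : ∀ i j → hex i ≡ hex j → i ≡ j
hex-injective = from-yes (all? λ i → all? λ j → (hex i ≟ᶠ hex j) →-dec (i ≟ᶠ j))

module GirthSix {m : ℕ} where
  open Removed {m}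
  open DartGraph (snarkDarts m)

  opaque
    unfolding target
    hexagon : HasCycleOfLength graph 6
    hexagon = record
      { m     = 3
      ; vtx   = λ i → code (base (hex i))
      ; inj   = λ {i} {j} e → hex-injective i j (inj₁-injective (code-injective e))
      ; edges = λ i → link-codes {base (hex (inject₁ i))} {base (hex (suc i))} (1F , cong (proj₁ ∘ fromTarget) (hex-forth i))
      ; close = link-codes {base (hex 5F)} {base (hex 0F)} (1F , refl)
      } , refl

  girth-6 : Girth graph 6
  girth-6 = hexagon , ShortCycles.no-short-cycle (snarkDarts m) (snarkNumbering m) not-short

-- Cyclic connectivity

+-swap : ∀ a b c → a + (b + c) ≡ b + (a + c)
+-swap = solve-∀

∑ : ∀ {n} → (Fin n → ℕ) → ℕ
∑ f = sum (tabulate f)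

∑-cong : ∀ {n} {f g : Fin n → ℕ} → (∀ i → f i ≡ g i) → ∑ f ≡ ∑ g
∑-cong {zero}  e = refl
∑-cong {suc n} e = cong₂ _+_ (e zero) (∑-cong (e ∘ suc))

∑-punchIn : ∀ {n} (f : Fin (suc n) → ℕ) r → ∑ f ≡ f r + ∑ (f ∘ punchIn r)
∑-punchIn f zero = refl
∑-punchIn {suc n} f (suc r) = trans (cong (f zero +_) (∑-punchIn (f ∘ suc) r)) (+-swap (f zero) (f (suc r)) _)

∑-concat : ∀ {A : Set} {n k} (w : A → ℕ) (g : Fin n → Fin k → A) →
  sum (map w (concat (tabulate λ i → tabulate (g i)))) ≡ ∑ λ i → ∑ λ j → w (g i j)
∑-concat {n = zero}  w g = refl
∑-concat {n = suc n} w g = trans (cong sum (map-++ w (tabulate (g zero)) _))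
  (trans (sum-++ (map w (tabulate (g zero))) _)
    (cong₂ _+_ (cong sum (map-tabulate (g zero) w)) (∑-concat w (g ∘ suc))))

bit : Bool → ℕ
bit true  = 1
bit false = 0

-- The contribution of an edge directed from a to b to the number of edges
-- leaving the set of vertices marked true; δ counts both directions.
cut δ : Bool → Bool → ℕ
cut a b = bit (a ∧ not b)
δ a b = cut a b + cut b a

δ-triangle : ∀ a b c → δ a c ≤ δ a b + δ b c
δ-triangle false false false = z≤n
δ-triangle false false true  = s≤s z≤n
δ-triangle false true  false = z≤n
δ-triangle false true  true  = s≤s z≤n
δ-triangle true  false false = s≤s z≤n
δ-triangle true  false true  = z≤n
δ-triangle true  true  false = s≤s z≤n
δ-triangle true  true  true  = z≤n

Leaves Block4 : Set
Leaves = Fin 3 → Bool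
Block4 = Fin 4 → Bool

leafBits : Block4 → Leaves
leafBits b l = b (suc l)

gap : Leaves → Leaves → ℕ
gap x y = ∑ λ l → cut (x l) (y l)

-- The cut edges within the star b and between b and the leaves x before it, added to r.
-- Accumulating them makes total-cut below hold by computation.
joinStar : Leaves → Block4 → ℕ → ℕ
joinStar x b r = δ (b 1F) (b 0F) + (δ (b 1F) (x 0F) + (δ (b 2F) (b 0F) + (δ (b 2F) (x 1F) +
             (δ (b 3F) (b 0F) + (δ (b 3F) (x 2F) + r)))))

chainCut : ∀ {n} → Leaves → (Fin n → Block4) → Leaves → ℕ
chainCut {zero}  x bs y = δ (y 0F) (x 0F) + (δ (y 1F) (x 1F) + (δ (y 2F) (x 2F) + 0))
chainCut {suc n} x bs y = joinStar x (bs zero) (chainCut (leafBits (bs zero)) (bs ∘ suc) y)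

join-mono : ∀ x b {r r′} → r ≤ r′ → joinStar x b r ≤ joinStar x b r′
join-mono x b = at (δ (b 1F) (b 0F)) ∘ at (δ (b 1F) (x 0F)) ∘ at (δ (b 2F) (b 0F)) ∘ at (δ (b 2F) (x 1F)) ∘
                at (δ (b 3F) (b 0F)) ∘ at (δ (b 3F) (x 2F))
  where
  at : ∀ a {r r′} → r ≤ r′ → a + r ≤ a + r′
  at a = ℕₚ.+-monoʳ-≤ a

-- By the triangle inequality for δ.
chainCut-drop : ∀ {n} x (bs : Fin (suc n) → Block4) y r → chainCut x (bs ∘ punchIn r) y ≤ chainCut x bs y
chainCut-drop {zero}  x bs y zero = ℕₚ.≤-trans
  (ℕₚ.+-mono-≤ (triangle 0F) (ℕₚ.+-mono-≤ (triangle 1F) (ℕₚ.+-monoˡ-≤ 0 (triangle 2F))))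
  -- The spokes of the dropped star are the slack in the inequality.
  (ℕₚ.≤-trans (ℕₚ.m≤m+n _ _) (ℕₚ.≤-reflexive (sym (regroup
    (δ (b 1F) (b 0F)) (δ (b 1F) (x 0F)) (δ (b 2F) (b 0F)) (δ (b 2F) (x 1F)) (δ (b 3F) (b 0F)) (δ (b 3F) (x 2F))
    (δ (y 0F) (b 1F)) (δ (y 1F) (b 2F)) (δ (y 2F) (b 3F))))))
  where
  b = bs zero
  triangle : ∀ l → δ (y l) (x l) ≤ δ (y l) (b (suc l)) + δ (b (suc l)) (x l)
  triangle l = δ-triangle (y l) (b (suc l)) (x l)
  regroup : ∀ q₁ s₁ q₂ s₂ q₃ s₃ u₁ u₂ u₃ →
    q₁ + (s₁ + (q₂ + (s₂ + (q₃ + (s₃ + (u₁ + (u₂ + (u₃ + 0)))))))) ≡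
    ((u₁ + s₁) + ((u₂ + s₂) + ((u₃ + s₃) + 0))) + (q₁ + q₂ + q₃)
  regroup = solve-∀
chainCut-drop {suc n} x bs y zero = ℕₚ.≤-trans
  (ℕₚ.+-monoʳ-≤ (δ (c 1F) (c 0F)) (ℕₚ.+-mono-≤ (triangle 0F) (ℕₚ.+-monoʳ-≤ (δ (c 2F) (c 0F)) (ℕₚ.+-mono-≤ (triangle 1F)
    (ℕₚ.+-monoʳ-≤ (δ (c 3F) (c 0F)) (ℕₚ.+-monoˡ-≤ rest (triangle 2F)))))))
  (ℕₚ.≤-trans (ℕₚ.m≤m+n _ _) (ℕₚ.≤-reflexive (sym (regroup
    (δ (b 1F) (b 0F)) (δ (b 1F) (x 0F)) (δ (b 2F) (b 0F)) (δ (b 2F) (x 1F)) (δ (b 3F) (b 0F)) (δ (b 3F) (x 2F))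
    (δ (c 1F) (c 0F)) (δ (c 1F) (b 1F)) (δ (c 2F) (c 0F)) (δ (c 2F) (b 2F)) (δ (c 3F) (c 0F)) (δ (c 3F) (b 3F)) rest))))
  where
  b = bs zero
  c = bs (suc zero)
  rest = chainCut (leafBits c) (λ i → bs (suc (suc i))) y
  triangle : ∀ l → δ (c (suc l)) (x l) ≤ δ (c (suc l)) (b (suc l)) + δ (b (suc l)) (x l)
  triangle l = δ-triangle (c (suc l)) (b (suc l)) (x l)
  regroup : ∀ q₁ s₁ q₂ s₂ q₃ s₃ p₁ u₁ p₂ u₂ p₃ u₃ r →
    q₁ + (s₁ + (q₂ + (s₂ + (q₃ + (s₃ + (p₁ + (u₁ + (p₂ + (u₂ + (p₃ + (u₃ + r))))))))))) ≡
    (p₁ + ((u₁ + s₁) + (p₂ + ((u₂ + s₂) + (p₃ + ((u₃ + s₃) + r)))))) + (q₁ + q₂ + q₃)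
  regroup = solve-∀
chainCut-drop {suc n} x bs y (suc r) = join-mono x (bs zero) (chainCut-drop (leafBits (bs zero)) (bs ∘ suc) y r)

starCut : Leaves → Block4 → Leaves → ℕ
starCut x b y = (∑ λ l → cut (b 0F) (b (suc l))) +
                ∑ λ l → ∑ (triple (cut (b (suc l)) (b 0F)) (cut (b (suc l)) (x l)) (cut (b (suc l)) (y l)))

-- A star counts only the darts at its own vertices. Adding the darts that come from the leaves
-- before it completes its left-hand edges to `δ`; its darts to the right are handed on as the `gap`
-- of the next star.
starCut-join : ∀ x b y r → starCut x b y + gap x (leafBits b) + r ≡ joinStar x b (gap (leafBits b) y + r)
starCut-join x b y r = regroup
  (cut (b 0F) (b 1F)) (cut (b 0F) (b 2F)) (cut (b 0F) (b 3F))
  (cut (b 1F) (b 0F)) (cut (b 1F) (x 0F)) (cut (b 1F) (y 0F)) (cut (x 0F) (b 1F))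
  (cut (b 2F) (b 0F)) (cut (b 2F) (x 1F)) (cut (b 2F) (y 1F)) (cut (x 1F) (b 2F))
  (cut (b 3F) (b 0F)) (cut (b 3F) (x 2F)) (cut (b 3F) (y 2F)) (cut (x 2F) (b 3F)) r
  where
  regroup : ∀ c₁ c₂ c₃ d₁ e₁ f₁ g₁ d₂ e₂ f₂ g₂ d₃ e₃ f₃ g₃ r →
    (c₁ + (c₂ + (c₃ + 0))) + ((d₁ + (e₁ + (f₁ + 0))) + ((d₂ + (e₂ + (f₂ + 0))) + ((d₃ + (e₃ + (f₃ + 0))) + 0))) +
      (g₁ + (g₂ + (g₃ + 0))) + r ≡
    (d₁ + c₁) + ((e₁ + g₁) + ((d₂ + c₂) + ((e₂ + g₂) + ((d₃ + c₃) + ((e₃ + g₃) + ((f₁ + (f₂ + (f₃ + 0))) + r))))))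
  regroup = solve-∀

prevLeaves : ∀ {n} → Leaves → (Fin n → Block4) → Fin n → Leaves
prevLeaves x bs i l = Maybe.maybe′ (λ j → leafBits (bs j) l) (x l) (prev i)

nextLeaves : ∀ {n} → Leaves → (Fin (suc n) → Block4) → Fin (suc n) → Leaves
nextLeaves y bs i l = Maybe.maybe′ (λ j → leafBits (bs j) l) (y l) (next i)

starCuts : ∀ {n} → Leaves → (Fin (suc n) → Block4) → Leaves → ℕ
starCuts x bs y = ∑ λ i → starCut (prevLeaves x bs i) (bs i) (nextLeaves y bs i)

starCut-cong : ∀ {x x′ y y′} b → (∀ l → x l ≡ x′ l) → (∀ l → y l ≡ y′ l) → starCut x b y ≡ starCut x′ b y′
starCut-cong b p q = cong ((∑ λ l → cut (b 0F) (b (suc l))) +_)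
  (∑-cong λ l → cong₂ (λ x y → ∑ (triple (cut (b (suc l)) (b 0F)) (cut (b (suc l)) x) (cut (b (suc l)) y))) (p l) (q l))

starCuts-suc : ∀ {n} x (bs : Fin (suc (suc n)) → Block4) y →
  starCuts x bs y ≡ starCut x (bs 0F) (leafBits (bs 1F)) + starCuts (leafBits (bs 0F)) (bs ∘ suc) y
starCuts-suc x bs y = cong (starCut x (bs 0F) (leafBits (bs 1F)) +_)
  (∑-cong λ i → starCut-cong (bs (suc i)) (λ l → onPrev i l) (λ l → onNext (next i) l))
  where
  onPrev : ∀ i l → prevLeaves x bs (suc i) l ≡ prevLeaves (leafBits (bs 0F)) (bs ∘ suc) i l
  onPrev zero    l = refl
  onPrev (suc i) l = refl
  onNext : ∀ n l → Maybe.maybe′ (λ j → leafBits (bs j) l) (y l) (Maybe.map suc n)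
                 ≡ Maybe.maybe′ (λ j → leafBits (bs (suc j)) l) (y l) n
  onNext (just _) l = refl
  onNext nothing  l = refl

starCuts-chainCut : ∀ {n} x (bs : Fin (suc n) → Block4) y →
  starCuts x bs y + gap x (leafBits (bs zero)) + gap y (leafBits (bs (fromℕ n))) ≡ chainCut x bs y
starCuts-chainCut {zero} x bs y = trans (cong (λ s → s + gap x (leafBits b) + gap y (leafBits b)) (ℕₚ.+-identityʳ (starCut x b y)))
  (trans (starCut-join x b y (gap y (leafBits b))) (cong (joinStar x b) (both (cut (b 1F) (y 0F)) (cut (b 2F) (y 1F)) (cut (b 3F) (y 2F))
    (cut (y 0F) (b 1F)) (cut (y 1F) (b 2F)) (cut (y 2F) (b 3F)))))
  where
  b = bs zero
  both : ∀ a₁ a₂ a₃ b₁ b₂ b₃ → (a₁ + (a₂ + (a₃ + 0))) + (b₁ + (b₂ + (b₃ + 0))) ≡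
    (b₁ + a₁) + ((b₂ + a₂) + ((b₃ + a₃) + 0))
  both = solve-∀
starCuts-chainCut {suc n} x bs y = trans (cong (λ s → s + gap x (leafBits (bs 0F)) + final) (starCuts-suc x bs y))
  (trans (move (starCut x (bs 0F) (leafBits (bs 1F))) rest (gap x (leafBits (bs 0F))) final)
    (trans (starCut-join x (bs 0F) (leafBits (bs 1F)) (rest + final))
      (cong (joinStar x (bs 0F)) (trans (turn (gap (leafBits (bs 0F)) (leafBits (bs 1F))) rest final)
        (starCuts-chainCut (leafBits (bs 0F)) (bs ∘ suc) y)))))
  where
  final = gap y (leafBits (bs (fromℕ (suc n))))
  rest = starCuts (leafBits (bs 0F)) (bs ∘ suc) y
  move : ∀ a b c d → a + b + c + d ≡ a + c + (b + d)
  move = solve-∀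
  turn : ∀ a b c → a + (b + c) ≡ b + a + c
  turn = solve-∀

Endpoint : Set
Endpoint = Fin 50 ⊎ (Fin 3 ⊎ Fin 3)

Arc : Set
Arc = Endpoint × Endpoint

_≟ᵃ_ : DecidableEquality Arc
_≟ᵃ_ = ×-≡-dec _≟ᵉ_ _≟ᵉ_

remove : Arc → List Arc → Maybe (List Arc)
remove a []       = nothing
remove a (b ∷ bs) = if does (a ≟ᵃ b) then just bs else Maybe.map (b ∷_) (remove a bs)

isPermutation : List Arc → List Arc → Bool
isPermutation []       []      = true
isPermutation []       (_ ∷ _) = false
isPermutation (a ∷ as) bs      = Maybe.maybe′ (isPermutation as) false (remove a bs)

remove-sum : ∀ (w : Arc → ℕ) a bs {cs} → remove a bs ≡ just cs → sum (map w bs) ≡ w a + sum (map w cs)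
remove-sum w a (b ∷ bs) e with a ≟ᵃ b
remove-sum w a (b ∷ bs) refl | yes refl = refl
... | no _ with remove a bs in eq
remove-sum w a (b ∷ bs) refl | no _ | just cs =
  trans (cong (w b +_) (remove-sum w a bs eq)) (+-swap (w b) (w a) (sum (map w cs)))

permutation-sum : ∀ (w : Arc → ℕ) as bs → T (isPermutation as bs) → sum (map w as) ≡ sum (map w bs)
permutation-sum w []       []       t = refl
permutation-sum w (a ∷ as) bs       t with remove a bs in eq
... | just cs = trans (cong (w a +_) (permutation-sum w as cs t)) (sym (remove-sum w a bs eq))

-- Each edge is listed from its later end, the moment at which the search, deciding vertices in
-- order, knows both ends.
earlier : Fin 50 → Target → List (Fin 50 × Fin 50)
earlier x (core (y , _)) = if toℕ y <ᵇ toℕ x then (x , y) ∷ [] else []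
earlier x (inj₂ _)       = []

coreEdges : List (Fin 50 × Fin 50)
coreEdges = concat (concat (tabulate λ x → tabulate λ i → earlier x (target x i)))

bothWays : List (Fin 50 × Fin 50) → List Arc
bothWays []             = []
bothWays ((p , q) ∷ es) = (inj₁ p , inj₁ q) ∷ (inj₁ q , inj₁ p) ∷ bothWays es

portArcs : List Arc
portArcs = tabulate (λ l → inj₁ (proj₁ (leftPort l)) , left l) ++ tabulate (λ l → inj₁ (proj₁ (rightPort l)) , right l)

coreArc : Fin 50 → Fin 3 → Arc
coreArc x i = inj₁ x , endpoint (target x i)

coreArcs : List Arc
coreArcs = concat (tabulate λ x → tabulate (coreArc x))

opaque
  unfolding target
  -- Every core edge arises from two darts, one in each direction, and every port from one; so the
  -- count by darts can be regrouped edge by edge.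
  core-permutation : T (isPermutation coreArcs (bothWays coreEdges ++ portArcs))
  core-permutation = tt

module Cut {m : ℕ} (σ : Vertex m → Bool) where
  leftBits rightBits : Leaves
  leftBits l  = σ (base (proj₁ (leftPort l)))
  rightBits l = σ (base (proj₁ (rightPort l)))

  stars : Fin (4 + m) → Block4
  stars i l = σ (star i l)

  cutAt : Vertex m → ℕ
  cutAt v = ∑ λ i → cut (σ v) (σ (chainNb v i))

  cutSize : ℕ
  cutSize = (∑ λ x → cutAt (base x)) + ∑ λ i → ∑ λ l → cutAt (star i l)

  weight : Arc → ℕ
  weight (p , q) = cut (σ (fromEndpoint p)) (σ (fromEndpoint q))

  edgeCut : Fin 50 × Fin 50 → ℕ
  edgeCut (p , q) = δ (σ (base p)) (σ (base q))

  bothWays-sum : ∀ es → sum (map weight (bothWays es)) ≡ sum (map edgeCut es)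
  bothWays-sum []             = refl
  bothWays-sum ((p , q) ∷ es) = trans (cong (λ s → cut (σ (base p)) (σ (base q)) + (cut (σ (base q)) (σ (base p)) + s)) (bothWays-sum es))
    (sym (ℕₚ.+-assoc (cut (σ (base p)) (σ (base q))) _ _))

  ports-sum : sum (map weight portArcs) ≡ gap leftBits (leafBits (stars zero)) + gap rightBits (leafBits (stars (fromℕ (3 + m))))
  ports-sum = assoc (g leftBits (stars zero) 0F) (g leftBits (stars zero) 1F) (g leftBits (stars zero) 2F) _
    where
    g : Leaves → Block4 → Fin 3 → ℕ
    g x b l = cut (x l) (b (suc l))
    assoc : ∀ a b c d → a + (b + (c + d)) ≡ (a + (b + (c + 0))) + d
    assoc = solve-∀

  base-sum : (∑ λ x → cutAt (base x)) ≡ sum (map edgeCut coreEdges) +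
    (gap leftBits (leafBits (stars zero)) + gap rightBits (leafBits (stars (fromℕ (3 + m)))))
  base-sum = trans (∑-cong λ x → ∑-cong λ i → cong (cut (σ (base x)) ∘ σ) (chainNb-base x i))
    (trans (sym (∑-concat {n = 50} {3} weight coreArc))
      (trans (permutation-sum weight coreArcs (bothWays coreEdges ++ portArcs) core-permutation)
        (trans (cong sum (map-++ weight (bothWays coreEdges) portArcs))
          (trans (sum-++ (map weight (bothWays coreEdges)) _) (cong₂ _+_ (bothWays-sum coreEdges) ports-sum)))))

  star-sum : ∀ i → (∑ λ l → cutAt (star i l)) ≡ starCut (prevLeaves leftBits stars i) (stars i) (nextLeaves rightBits stars i)
  star-sum i = cong ((∑ λ l → cut (σ (star i 0F)) (σ (star i (suc l)))) +_) (∑-cong leaf)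
    where
    via : ∀ l j (d : Dart (Fin 50)) n → σ (proj₁ (along {m} (suc l) j d n)) ≡
          Maybe.maybe′ (λ k → leafBits (stars k) l) (σ (base (proj₁ d))) n
    via l j d (just _) = refl
    via l j d nothing  = refl
    leaf : ∀ l → cutAt (star i (suc l)) ≡ ∑ (triple (cut (stars i (suc l)) (stars i 0F))
      (cut (stars i (suc l)) (prevLeaves leftBits stars i l)) (cut (stars i (suc l)) (nextLeaves rightBits stars i l)))
    leaf l = cong (cut (stars i (suc l)) (stars i 0F) +_) (cong₂ _+_
      (cong (cut (stars i (suc l))) (via l 2F (leftPort l) (prev i)))
      (cong (_+ 0) (cong (cut (stars i (suc l))) (via l 1F (rightPort l) (next i)))))

  cutSize-split : cutSize ≡ sum (map edgeCut coreEdges) + chainCut leftBits stars rightBits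
  cutSize-split = trans (cong₂ _+_ base-sum (∑-cong star-sum))
    (trans (regroup (sum (map edgeCut coreEdges)) (gap leftBits (leafBits (stars zero))) (gap rightBits (leafBits (stars (fromℕ (3 + m))))) (starCuts leftBits stars rightBits))
      (cong (sum (map edgeCut coreEdges) +_) (starCuts-chainCut leftBits stars rightBits)))
    where
    regroup : ∀ k g h s → k + (g + h) + s ≡ k + (s + g + h)
    regroup = solve-∀

  size : ℕ
  size = (∑ λ x → bit (σ (base x))) + ∑ λ i → ∑ λ l → bit (σ (star i l))

-- Reduction of small cuts to the chain of four stars

dropStar : ∀ {m} → Fin (5 + m) → Vertex m → Vertex (suc m)
dropStar r (base x)   = base x
dropStar r (star i l) = star (punchIn r i) l

cutSize-drop : ∀ {m} (σ : Vertex (suc m) → Bool) r → Cut.cutSize (σ ∘ dropStar r) ≤ Cut.cutSize σ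
cutSize-drop σ r = subst₂ _≤_ (sym (Cut.cutSize-split (σ ∘ dropStar r))) (sym cutSize-split)
  (ℕₚ.+-monoʳ-≤ (sum (map edgeCut coreEdges)) (chainCut-drop leftBits stars rightBits r))
  where open Cut σ

starSize : ∀ {m} → (Vertex m → Bool) → Fin (4 + m) → ℕ
starSize σ i = ∑ λ l → bit (σ (star i l))

size-drop : ∀ {m} (σ : Vertex (suc m) → Bool) r → Cut.size σ ≡ starSize σ r + Cut.size (σ ∘ dropStar r)
size-drop σ r = trans (cong ((∑ λ x → bit (σ (base x))) +_) (∑-punchIn (starSize σ) r)) (+-swap (∑ λ x → bit (σ (base x))) (starSize σ r) _)

-- A backtracking search over all vertex sets.  Vertices are decided one by one,
-- newest first in the history; each row lists the pairs of positions in the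
-- history between which an edge is counted after its vertex has been decided.
Row : Set
Row = List (ℕ × ℕ)

pairCut : List Bool → ℕ × ℕ → ℕ
pairCut h (i , j) = δ (nth false h i) (nth false h j)

rowCut : List Bool → Row → ℕ → ℕ
rowCut h row r = foldr (λ e s → pairCut h e + s) r row

total : List Row → List Bool → List Bool → ℕ
total []           h bs       = 0
total (row ∷ rows) h []       = 0
total (row ∷ rows) h (b ∷ bs) = rowCut (b ∷ h) row (total rows (b ∷ h) bs)

within : ℕ → ℕ → (ℕ → Bool) → Bool
within c k f = if c ≤ᵇ k then f (k ∸ c) else true

-- Whether every set that has a cut of at most k further edges is too small:
-- it lacks t true or f false vertices.
search : List Row → List Bool → ℕ → ℕ → ℕ → Bool
search []           h k zero zero = false
search []           h k t    f    = true
search (row ∷ rows) h k t    f    = branch true (t ∸ 1) f ∧ branch false t (f ∸ 1)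
  where
  branch : Bool → ℕ → ℕ → Bool
  branch b t f = within (rowCut (b ∷ h) row 0) k λ k′ → search rows (b ∷ h) k′ t f

rowCut-+ : ∀ h row r → rowCut h row r ≡ rowCut h row 0 + r
rowCut-+ h []        r = refl
rowCut-+ h (e ∷ row) r = trans (cong (pairCut h e +_) (rowCut-+ h row r)) (sym (ℕₚ.+-assoc (pairCut h e) (rowCut h row 0) r))

∧-split : ∀ {a b} → T (a ∧ b) → T a × T b
∧-split {true} t = tt , t

search-sound : ∀ rows h k t f → T (search rows h k t f) → ∀ bs → length bs ≡ length rows →
  total rows h bs ≤ k → t ≤ sum (map bit bs) → f ≤ sum (map (bit ∘ not) bs) → ⊥
search-sound [] h k zero    zero    () [] refl _ _ _
search-sound [] h k (suc t) f       _  [] refl _ () _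
search-sound [] h k zero    (suc f) _  [] refl _ _ ()
search-sound (row ∷ rows) h k t f ok (b ∷ bs) len cost t≤ f≤ = decide b cost t≤ f≤
  where
  continue : ∀ b t f → total (row ∷ rows) h (b ∷ bs) ≤ k →
    T (within (rowCut (b ∷ h) row 0) k λ k′ → search rows (b ∷ h) k′ t f) →
    t ≤ sum (map bit bs) → f ≤ sum (map (bit ∘ not) bs) → ⊥
  continue b t f cost ok t≤ f≤ with rowCut (b ∷ h) row 0 | rowCut-+ (b ∷ h) row (total rows (b ∷ h) bs)
  ... | c | e with c ≤ᵇ k in q
  ...   | true  = search-sound rows (b ∷ h) (k ∸ c) t f ok bs (ℕₚ.suc-injective len)
    (ℕₚ.≤-trans (ℕₚ.≤-reflexive (sym (ℕₚ.m+n∸m≡n c _))) (ℕₚ.∸-monoˡ-≤ c (subst (_≤ k) e cost))) t≤ f≤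
  ...   | false = subst T q (ℕₚ.≤⇒≤ᵇ (ℕₚ.≤-trans (ℕₚ.m≤m+n c _) (subst (_≤ k) e cost)))
  lower : ∀ {a n} → a ≤ suc n → a ∸ 1 ≤ n
  lower {zero}  _         = z≤n
  lower {suc a} (s≤s a≤n) = a≤n
  decide : ∀ b → total (row ∷ rows) h (b ∷ bs) ≤ k →
    t ≤ bit b + sum (map bit bs) → f ≤ bit (not b) + sum (map (bit ∘ not) bs) → ⊥
  decide true  cost t≤ f≤ = continue true (t ∸ 1) f cost (proj₁ (∧-split ok)) (lower t≤) f≤
  decide false cost t≤ f≤ = continue false t (f ∸ 1) cost (proj₂ (∧-split ok)) t≤ (lower f≤)

-- The vertex `star i l` has number 50 + 4i + l, and a position in the history is the distance to
-- the newest number. The edges to the right ports are counted only after the last vertex, number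
-- 65, because `chainCut` puts them last.
baseRows starRows : List Row
baseRows = tabulate λ x → map (λ (_ , y) → 0 , toℕ x ∸ toℕ y) (concat (tabulate λ i → earlier x (target x i)))
starRows = concat (tabulate {n = 4} λ i → [] ∷ tabulate (row i))
  where
  portIndex : (Fin 3 → Dart (Fin 50)) → Fin 3 → ℕ
  portIndex port l = toℕ (proj₁ (port l))
  closing : Row
  closing = tabulate λ l → 65 ∸ portIndex rightPort l , 2 ∸ toℕ l
  row : Fin 4 → Fin 3 → Row
  row 0F l  = (0 , suc (toℕ l)) ∷ (0 , 51 + toℕ l ∸ portIndex leftPort l) ∷ []
  row 3F 2F = (0 , 3) ∷ (0 , 4) ∷ closing
  row _  l  = (0 , suc (toℕ l)) ∷ (0 , 4) ∷ []

starBits bits : (Vertex 0 → Bool) → List Bool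
starBits σ = concat (tabulate λ i → tabulate λ l → σ (star i l))
bits σ     = tabulate (σ ∘ inj₁) ++ starBits σ

foldr-sum : ∀ {A : Set} (w : A → ℕ) es r → foldr (λ e s → w e + s) r es ≡ sum (map w es) + r
foldr-sum w []       r = refl
foldr-sum w (e ∷ es) r = trans (cong (w e +_) (foldr-sum w es r)) (sym (ℕₚ.+-assoc (w e) (sum (map w es)) r))

bits-sum : ∀ (f : Bool → ℕ) σ → sum (map f (bits σ)) ≡ (∑ λ x → f (σ (base x))) + ∑ λ i → ∑ λ l → f (σ (star i l))
bits-sum f σ = trans (cong sum (map-++ f (tabulate (σ ∘ inj₁)) (starBits σ)))
  (trans (sum-++ (map f (tabulate (σ ∘ inj₁))) (map f (starBits σ)))
    (cong₂ _+_ (cong sum (map-tabulate (σ ∘ inj₁) f)) (∑-concat f (λ i l → σ (star i l)))))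

opaque
  unfolding target
  total-cut : ∀ σ → let open Cut {0} σ in
    total (baseRows ++ starRows) [] (bits σ) ≡ foldr (λ e s → edgeCut e + s) (chainCut leftBits stars rightBits) coreEdges
  total-cut σ = refl

  rows-length : ∀ σ → length (bits σ) ≡ length (baseRows ++ starRows)
  rows-length σ = refl

  search-true : T (search (baseRows ++ starRows) [] 4 3 3)
  search-true = tt

-- A side that contains a cycle has at least three vertices. The bound cannot be lowered: two
-- adjacent vertices are cut off by four edges.
smallest-no-cut : (σ : Vertex 0 → Bool) → Cut.cutSize σ ≤ 4 → 3 ≤ Cut.size σ → 3 ≤ Cut.size (not ∘ σ) → ⊥
smallest-no-cut σ c≤4 3≤s 3≤t = search-sound (baseRows ++ starRows) [] 4 3 3 search-true (bits σ) (rows-length σ)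
  (subst (_≤ 4) (trans cutSize-split (trans (sym (foldr-sum edgeCut coreEdges (chainCut leftBits stars rightBits))) (sym (total-cut σ)))) c≤4)
  (subst (3 ≤_) (sym (bits-sum bit σ)) 3≤s)
  (subst (3 ≤_) (sym (bits-sum (bit ∘ not) σ)) 3≤t)
  where open Cut σ

-- If every choice failed, each term would be at least s - 2, so 4(s - 2) ≤ s and s ≤ 2. Three terms
-- would not do, as 1, 1, 1 with s = 3 shows.
pick : ∀ s (a : Fin 4 → ℕ) → ∑ a ≤ s → 3 ≤ s → ∃ λ r → 3 + a r ≤ s
pick s a ∑≤s 3≤s with any? (λ r → 3 + a r ≤? s)
... | yes p = p
... | no ¬p = ⊥-elim (absurd s ∑≤s 3≤s (λ r → ℕₚ.≰⇒> (λ q → ¬p (r , q))))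
  where
  open ℕₚ.≤-Reasoning
  absurd : ∀ s → ∑ a ≤ s → 3 ≤ s → (∀ r → suc s ≤ 3 + a r) → ⊥
  absurd (suc (suc (suc s))) ∑≤s (s≤s (s≤s (s≤s z≤n))) small = ℕₚ.<-irrefl refl (begin-strict
    15 + s                                                      <⟨ ℕₚ.m≤m+n (16 + s) (3 * s) ⟩
    16 + s + 3 * s                                              ≡⟨ expand s ⟩
    (4 + s) + ((4 + s) + ((4 + s) + ((4 + s) + 0)))             ≤⟨ ℕₚ.+-mono-≤ (small 0F) (ℕₚ.+-mono-≤ (small 1F)
                                                                     (ℕₚ.+-mono-≤ (small 2F) (ℕₚ.+-monoˡ-≤ 0 (small 3F)))) ⟩
    (3 + a 0F) + ((3 + a 1F) + ((3 + a 2F) + ((3 + a 3F) + 0))) ≡⟨ collect (a 0F) (a 1F) (a 2F) (a 3F) ⟩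
    12 + ∑ a                                                    ≤⟨ ℕₚ.+-monoʳ-≤ 12 ∑≤s ⟩
    15 + s                                                      ∎)
    where
    expand : ∀ s → 16 + s + 3 * s ≡ (4 + s) + ((4 + s) + ((4 + s) + ((4 + s) + 0)))
    expand = solve-∀
    collect : ∀ a b c d → (3 + a) + ((3 + b) + ((3 + c) + ((3 + d) + 0))) ≡ 12 + (a + (b + (c + (d + 0))))
    collect = solve-∀

interleave : ∀ a b c d e f g h → (a + (b + (c + (d + 0)))) + (e + (f + (g + (h + 0)))) ≡
  (a + e) + ((b + f) + ((c + g) + ((d + h) + 0)))
interleave = solve-∀

bit-not : ∀ b → bit b + bit (not b) ≡ 1
bit-not true  = refl
bit-not false = refl

starSize-complement : ∀ {m} (σ : Vertex m → Bool) i → starSize σ i + starSize (not ∘ σ) i ≡ 4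
starSize-complement σ i = trans (interleave (b 0F) (b 1F) (b 2F) (b 3F) (b′ 0F) (b′ 1F) (b′ 2F) (b′ 3F))
  (cong₂ _+_ (both 0F) (cong₂ _+_ (both 1F) (cong₂ _+_ (both 2F) (cong (_+ 0) (both 3F)))))
  where
  b b′ : Fin 4 → ℕ
  b l  = bit (σ (star i l))
  b′ l = bit (not (σ (star i l)))
  both : ∀ l → b l + b′ l ≡ 1
  both l = bit-not (σ (star i l))

module _ {m : ℕ} (σ : Vertex (suc m) → Bool) where
  firstStars : Fin 4 → ℕ
  firstStars r = starSize σ (r ↑ˡ suc m)

  firstStars-size : ∑ firstStars ≤ Cut.size σ
  firstStars-size = ℕₚ.≤-trans (ℕₚ.≤-trans (ℕₚ.m≤m+n (∑ firstStars) rest) (ℕₚ.≤-reflexive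
      (regroup (firstStars 0F) (firstStars 1F) (firstStars 2F) (firstStars 3F) rest)))
      (ℕₚ.m≤n+m _ (∑ λ x → bit (σ (base x))))
    where
    rest = ∑ λ i → starSize σ (4 ↑ʳ i)
    regroup : ∀ a b c d e → (a + (b + (c + (d + 0)))) + e ≡ a + (b + (c + (d + e)))
    regroup = solve-∀

  firstStars≤4 : ∀ r → firstStars r ≤ 4
  firstStars≤4 r = subst (firstStars r ≤_) (starSize-complement σ (r ↑ˡ suc m)) (ℕₚ.m≤m+n _ _)

  still-large : ∀ r → 3 + firstStars r ≤ Cut.size σ → 3 ≤ Cut.size (σ ∘ dropStar (r ↑ˡ suc m))
  still-large r p = ℕₚ.+-cancelˡ-≤ (firstStars r) 3 _
    (subst₂ _≤_ (ℕₚ.+-comm 3 (firstStars r)) (size-drop σ (r ↑ˡ suc m)) p)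

-- If each of the first four stars were indispensable to the same side, that
-- side would have fewer than three vertices; and only a side with at most six
-- vertices has an indispensable star.
droppable : ∀ {m} (σ : Vertex (suc m) → Bool) → 3 ≤ Cut.size σ → 3 ≤ Cut.size (not ∘ σ) →
  ∃ λ r → 3 ≤ Cut.size (σ ∘ dropStar r) × 3 ≤ Cut.size (not ∘ σ ∘ dropStar r)
droppable {m} σ 3≤s 3≤t with 7 ≤? Cut.size σ
... | yes 7≤s with pick _ (firstStars (not ∘ σ)) (firstStars-size (not ∘ σ)) 3≤t
...   | r , p = r ↑ˡ suc m , still-large σ r (ℕₚ.≤-trans (ℕₚ.+-monoʳ-≤ 3 (firstStars≤4 σ r)) 7≤s) , still-large (not ∘ σ) r p
droppable {m} σ 3≤s 3≤t | no s≤6 with pick _ (firstStars σ) (firstStars-size σ) 3≤s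
... | r , p = r ↑ˡ suc m , still-large σ r p ,
    still-large (not ∘ σ) r (ℕₚ.≤-trans (ℕₚ.+-monoʳ-≤ 3 (firstStars≤4 (not ∘ σ) r)) 7≤t)
  where
  open ℕₚ.≤-Reasoning
  sixteen : ∑ (firstStars σ) + ∑ (firstStars (not ∘ σ)) ≡ 16
  sixteen = trans (interleave (firstStars σ 0F) (firstStars σ 1F) (firstStars σ 2F) (firstStars σ 3F) _ _ _ _)
    (cong₂ _+_ (starSize-complement σ 0F) (cong₂ _+_ (starSize-complement σ 1F) (cong₂ _+_ (starSize-complement σ 2F)
      (cong (_+ 0) (starSize-complement σ 3F)))))
  -- The four stars have 16 vertices, of which the small side holds at most six, so at least ten are
  -- left for the other.
  7≤t : 7 ≤ Cut.size (not ∘ σ)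
  7≤t = ℕₚ.≤-trans (ℕₚ.m≤m+n 7 3) (ℕₚ.+-cancelˡ-≤ 6 10 _ (begin
    16                                              ≡⟨ sixteen ⟨
    ∑ (firstStars σ) + ∑ (firstStars (not ∘ σ))     ≤⟨ ℕₚ.+-mono-≤ (firstStars-size σ) (firstStars-size (not ∘ σ)) ⟩
    Cut.size σ + Cut.size (not ∘ σ)                 ≤⟨ ℕₚ.+-monoˡ-≤ _ (ℕₚ.≤-pred (ℕₚ.≰⇒> s≤6)) ⟩
    6 + Cut.size (not ∘ σ)                          ∎))

no-small-cut : ∀ m (σ : Vertex m → Bool) → Cut.cutSize σ ≤ 4 → 3 ≤ Cut.size σ → 3 ≤ Cut.size (not ∘ σ) → ⊥
no-small-cut zero    σ c s t = smallest-no-cut σ c s t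
no-small-cut (suc m) σ c s t with droppable σ s t
... | r , s′ , t′ = no-small-cut m (σ ∘ dropStar r) (ℕₚ.≤-trans (cutSize-drop σ r) c) s′ t′

-- From separating edge sets to cuts of vertex sets

∑-+ : ∀ a {b} (f : Fin (a + b) → ℕ) → ∑ f ≡ ∑ (f ∘ (_↑ˡ b)) + ∑ (f ∘ (a ↑ʳ_))
∑-+ zero    f = refl
∑-+ (suc a) f = trans (cong (f zero +_) (∑-+ a (f ∘ suc))) (sym (ℕₚ.+-assoc (f zero) _ _))

∑-combine : ∀ n {k} (f : Fin (n * k) → ℕ) → ∑ f ≡ ∑ λ i → ∑ λ j → f (combine {n} i j)
∑-combine zero        f = refl
∑-combine (suc n) {k} f = trans (∑-+ k f) (cong ((∑ λ j → f (j ↑ˡ n * k)) +_) (∑-combine n (f ∘ (k ↑ʳ_))))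

count-≤ : ∀ {k} {A : Set} (p : Fin k → Bool) (f : Fin k → A) (ys : List A) →
  (∀ {i j} → f i ≡ f j → i ≡ j) → (∀ i → T (p i) → f i ∈ ys) → ∑ (bit ∘ p) ≤ length ys
count-≤ {zero}  p f ys inj mem = z≤n
count-≤ {suc k} p f ys inj mem with p zero in eq
... | false = count-≤ (p ∘ suc) (f ∘ suc) ys (λ e → suc-injective (inj e)) (mem ∘ suc)
... | true with ∈-∃++ (mem zero (subst T (sym eq) tt))
...   | as , bs , refl = subst (suc (∑ (bit ∘ p ∘ suc)) ≤_) (sym (trans (length-++ as) (trans (ℕₚ.+-suc (length as) (length bs)) (cong suc (sym (length-++ as))))))
  (s≤s (count-≤ (p ∘ suc) (f ∘ suc) (as ++ bs) (λ e → suc-injective (inj e)) mem′))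
  where
  mem′ : ∀ i → T (p (suc i)) → f (suc i) ∈ as ++ bs
  mem′ i t with ∈-++⁻ as (mem (suc i) t)
  ... | inj₁ q         = ∈-++⁺ˡ q
  ... | inj₂ (here e)  with inj e
  ...   | ()
  mem′ i t | inj₂ (there q) = ∈-++⁺ʳ as q

count-filter : ∀ {A : Set} (P : A → Bool) {n} (g : Fin n → A) →
  length (filter (T? ∘ P) (tabulate g)) ≡ ∑ (bit ∘ P ∘ g)
count-filter P {zero}  g = refl
count-filter P {suc n} g with P (g zero)
... | true  = cong suc (count-filter P (g ∘ suc))
... | false = count-filter P (g ∘ suc)

three-members : ∀ {n} (S : Fin n → Bool) (w : Fin 3 → Fin n) → (∀ {i j} → w i ≡ w j → i ≡ j) →
  (∀ i → T (S (w i))) → 3 ≤ ∑ (bit ∘ S)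
three-members S w inj t = subst (3 ≤_) (count-filter S id)
  (count-≤ (λ _ → true) w (filter (T? ∘ S) (allFin _)) inj (λ i _ → ∈-filter⁺ (T? ∘ S) (∈-allFin (w i)) (t i)))

-- Finiteness of the index set makes this constructive; it allows reachability to be decided at all
-- vertices at once, the eventual goal being a negation.
¬¬-∀ : ∀ {n} {P : Fin n → Set} → (∀ i → ¬ ¬ P i) → ¬ ¬ (∀ i → P i)
¬¬-∀ {zero}  h k = k (λ ())
¬¬-∀ {suc n} h k = h zero λ p → ¬¬-∀ (h ∘ suc) λ ps → k λ { zero → p ; (suc i) → ps i }

module Boundary {V : Set} {n : ℕ} (D : DartGraph V) (N : Numbering V n) where
  open DartGraph D
  open Numbering N
  open Realise D N

  leaving : (Fin n → Bool) → Fin n → Fin 3 → Bool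
  leaving S x i = S x ∧ not (S (code (nb (vert x) i)))

  -- In a simple graph a dart is determined by the ordered pair of its ends. Turning each member of
  -- `F` so that it starts in `S` therefore lets the leaving darts inject into `F`, whichever way
  -- its pairs are written.
  boundary-≤ : ∀ (S : Fin n → Bool) (F : List (Fin n × Fin n)) →
    (∀ x y → Adj graph x y → T (S x) → T (not (S y)) → (x , y) ∈ F ⊎ (y , x) ∈ F) →
    ∑ (λ x → ∑ λ i → bit (leaving S x i)) ≤ length F
  boundary-≤ S F covered = subst₂ _≤_ combined (length-map orient F)
    (count-≤ (uncurry (leaving S) ∘ remQuot 3) (pair ∘ remQuot 3) (map orient F) pair-injective member)
    where
    pair : Fin n × Fin 3 → Fin n × Fin n
    pair (x , i) = x , code (nb (vert x) i)
    orient : Fin n × Fin n → Fin n × Fin n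
    orient (x , y) = if S x then x , y else (y , x)
    combined : ∑ (bit ∘ uncurry (leaving S) ∘ remQuot 3) ≡ ∑ λ x → ∑ λ i → bit (leaving S x i)
    combined = trans (∑-combine n (bit ∘ uncurry (leaving S) ∘ remQuot 3))
      (∑-cong λ x → ∑-cong λ i → cong (bit ∘ uncurry (leaving S)) (remQuot-combine x i))
    same-dart : ∀ a b → pair a ≡ pair b → a ≡ b
    same-dart (x , i) (y , j) e with cong proj₁ e
    ... | refl = cong (x ,_) (nb-injective (vert x) (code-injective (cong proj₂ e)))
    pair-injective : ∀ {i j} → pair (remQuot {n} 3 i) ≡ pair (remQuot {n} 3 j) → i ≡ j
    pair-injective {i} {j} e = trans (sym (combine-remQuot {n} 3 i))
      (trans (cong (uncurry combine) (same-dart (remQuot {n} 3 i) (remQuot {n} 3 j) e)) (combine-remQuot {n} 3 j))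
    ∧-T : ∀ a {b} → T (a ∧ b) → T a × T b
    ∧-T true t = tt , t
    oriented : ∀ x y → T (S x) → T (not (S y)) → (x , y) ∈ F ⊎ (y , x) ∈ F → (x , y) ∈ map orient F
    oriented x y sx sy (inj₁ p) = subst (_∈ map orient F) (forth (S x) sx) (∈-map⁺ orient p)
      where
      forth : ∀ b → T b → (if b then (x , y) else (y , x)) ≡ (x , y)
      forth true _ = refl
    oriented x y sx sy (inj₂ p) = subst (_∈ map orient F) (back (S y) sy) (∈-map⁺ orient p)
      where
      back : ∀ b → T (not b) → (if b then (y , x) else (x , y)) ≡ (x , y)
      back false _ = refl
    crossing : ∀ d → T (uncurry (leaving S) d) → pair d ∈ map orient F
    crossing (x , i) t = oriented x (code (nb (vert x) i)) (proj₁ st) (proj₂ st)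
      (covered x (code (nb (vert x) i)) (link⇒adj (i , sym (vert-code _))) (proj₁ st) (proj₂ st))
      where
      st = ∧-T (S x) t
    member : ∀ k → T (uncurry (leaving S) (remQuot {n} 3 k)) → pair (remQuot {n} 3 k) ∈ map orient F
    member k = crossing (remQuot {n} 3 k)

module Separation {n : ℕ} (G : Graph n) (F : List (Fin n × Fin n)) where
  E : Fin n → Fin n → Set
  E = AdjMinus G F

  E-sym : ∀ {u v} → E u v → E v u
  E-sym {u} {v} (a , p , q) = subst T (Graph.sym G u v) a , q , p

  reach-trans : ∀ {u v w} → Reach E u v → Reach E v w → Reach E u w
  reach-trans here       q = q
  reach-trans (step e p) q = step e (reach-trans p q)

  reach-sym : ∀ {u v} → Reach E u v → Reach E v u
  reach-sym here       = here
  reach-sym (step e p) = reach-trans (reach-sym p) (step (E-sym e) here)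

  around : ∀ (C : CycleIn E) i → Reach E (vtx C zero) (vtx C i)
  around C = <-weakInduction (λ i → Reach E (vtx C zero) (vtx C i)) here
    (λ i r → reach-trans r (step (edges C i) here))

  -- Three vertices are all that the search asks of a cycle.
  first-three : ∀ (C : CycleIn E) → Fin 3 → Fin n
  first-three C i = vtx C (i ↑ˡ CycleIn.m C)

  first-three-injective : ∀ C {i j} → first-three C i ≡ first-three C j → i ≡ j
  first-three-injective C e = ↑ˡ-injective _ _ _ (inj C e)

  -- S is the component of the first cycle; reachability is decided classically.
  boundary-of-separation : SeparatesTwoCycles G F → ¬ ¬ (Σ (Fin n → Bool) λ S →
    (∀ x y → Adj G x y → T (S x) → T (not (S y)) → (x , y) ∈ F ⊎ (y , x) ∈ F) ×
    3 ≤ ∑ (bit ∘ S) × 3 ≤ ∑ (bit ∘ not ∘ S))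
  boundary-of-separation (C₁ , C₂ , apart) k = ¬¬-∀ {P = λ v → Dec (Reach E root v)} (λ v → ¬¬-excluded-middle) found
    where
    root = vtx C₁ zero
    found : ¬ (∀ v → Dec (Reach E root v))
    found reach? = k (S , covered , three-members S (first-three C₁) (first-three-injective C₁) inside
                                  , three-members (not ∘ S) (first-three C₂) (first-three-injective C₂) outside)
      where
      S : Fin n → Bool
      S v = does (reach? v)
      holds : ∀ {v} → Reach E root v → T (S v)
      holds {v} r = subst T (sym (dec-true (reach? v) r)) tt
      fails : ∀ {v} → ¬ Reach E root v → T (not (S v))
      fails {v} r = subst (T ∘ not) (sym (dec-false (reach? v) r)) tt
      fails⁻ : ∀ v → T (not (S v)) → ¬ Reach E root v
      fails⁻ v t r = subst (T ∘ not) (dec-true (reach? v) r) t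
      inside : ∀ i → T (S (first-three C₁ i))
      inside i = holds (around C₁ (i ↑ˡ CycleIn.m C₁))
      outside : ∀ i → T (not (S (first-three C₂ i)))
      outside i = fails λ r → apart (reach-trans r (reach-sym (around C₂ (i ↑ˡ CycleIn.m C₂))))
      _∈F? : ∀ e → Dec (e ∈ F)
      e ∈F? = _∈?_ (×-≡-dec _≟ᶠ_ _≟ᶠ_) e F
      covered : ∀ x y → Adj G x y → T (S x) → T (not (S y)) → (x , y) ∈ F ⊎ (y , x) ∈ F
      covered x y a sx sy with (x , y) ∈F? | (y , x) ∈F?
      ... | yes p | _     = inj₁ p
      ... | no _  | yes q = inj₂ q
      ... | no p  | no q  = ⊥-elim (fails⁻ y sy (reach-trans (decided (reach? x) sx) (step (a , p , q) here)))

module Cyclic (m : ℕ) where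
  open Numbering (snarkNumbering m)
  open DartGraph (snarkDarts m) using (nb)
  open Realise (snarkDarts m) (snarkNumbering m)
  open Boundary (snarkDarts m) (snarkNumbering m)

  opaque
    unfolding snarkNumbering

    code-base : ∀ x → x ↑ˡ (4 + m) * 4 ≡ code (base x)
    code-base x = refl

    code-star : ∀ i l → 50 ↑ʳ combine {4 + m} i l ≡ code (star i l)
    code-star i l = refl

  ∑-vertices : ∀ (f : Vertex m → ℕ) → ∑ (f ∘ vert) ≡ (∑ λ x → f (base x)) + ∑ λ i → ∑ λ l → f (star i l)
  ∑-vertices f = trans (∑-+ 50 (f ∘ vert)) (cong₂ _+_
    (∑-cong λ x → cong f (trans (cong vert (code-base x)) (vert-code (base x))))
    (trans (∑-combine (4 + m) {4} (f ∘ vert ∘ (50 ↑ʳ_)))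
      (∑-cong λ i → ∑-cong λ l → cong f (trans (cong vert (code-star i l)) (vert-code (star i l))))))

  cyclically-5-connected : CyclicallyConnected 5 graph
  cyclically-5-connected F (s≤s F≤4) separates = Separation.boundary-of-separation graph F separates λ
    (S , covered , 3≤S , 3≤S′) → no-small-cut m (S ∘ code)
      (ℕₚ.≤-trans (subst (_≤ length F) (cuts S) (boundary-≤ S F covered)) F≤4)
      (subst (3 ≤_) (sizes (bit ∘ S)) 3≤S)
      (subst (3 ≤_) (sizes (bit ∘ not ∘ S)) 3≤S′)
    where
    sizes : ∀ (f : Fin _ → ℕ) → ∑ f ≡ (∑ λ x → f (code (base x))) + ∑ λ i → ∑ λ l → f (code (star i l))
    sizes f = trans (∑-cong {g = f ∘ code ∘ vert} λ x → cong f (sym (code-vert x))) (∑-vertices (f ∘ code))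
    cuts : ∀ S → ∑ (λ x → ∑ λ i → bit (leaving S x i)) ≡ Cut.cutSize (S ∘ code)
    cuts S = trans (∑-cong {g = Cut.cutAt (S ∘ code) ∘ vert} λ x → ∑-cong λ i → cong (λ y → bit (S y ∧ not (S (code (nb (vert x) i))))) (sym (code-vert x)))
      (∑-vertices (Cut.cutAt (S ∘ code)))

-- Strict criticality and the order of the graph

module Conclusion (k : ℕ) where
  open Even k
  open Numbering (snarkNumbering (k * 2))
  open Realise (snarkDarts (k * 2)) (snarkNumbering (k * 2))
  open Removed {k * 2} using (hub; removal-uncolourable; not-3-colourable)

  snark : Snark graph
  snark = connected (base zero) (Shape.root (k * 2)) , cubic , colourable-4 , not-3-colourable k refl
    where
    open ColouringOn four-colouring
    colourable-4 : EdgeColourable 4 graph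
    colourable-4 = colourable γ (λ _ → true) agree (λ x _ → rainbow-injective (γ (vert x)) (proper (vert x) tt))

  edge-removal : ∀ x y → x ≢ y → Adj graph x y → RemovalColourable graph x y
  edge-removal x y _ a with adj⇒link {x} {y} a
  ... | i , e = colourable γ (others x y) agree λ z kz → rainbow-injective (γ (vert z))
    (proper (vert z) ((λ p → others-≢ˡ kz (vert-injective {z} {x} p)) , λ p → others-≢ʳ kz (vert-injective {z} {y} (trans p e))))
    where open ColouringOn (near (vert x) i)

  strictly-critical : StrictlyCritical graph
  strictly-critical = (snark , edge-removal) , λ (_ , removable) →
    removal-uncolourable k refl (removable (code (hub 0F)) (code (hub 1F)) (λ e → distinct (code-injective {hub 0F} {hub 1F} e)))
    where
    distinct : hub 0F ≢ hub 1F
    distinct ()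

order : ∀ n → 66 ≤ n → n % 8 ≡ 2 → ∃ λ k → 50 + (4 + k * 2) * 4 ≡ n
-- The least order is 66 = 2 + 8 · 8, so k is the excess of the quotient over eight.
order n 66≤n n%8≡2 = n / 8 ∸ 8 , sym (begin
  n                                 ≡⟨ m≡m%n+[m/n]*n n 8 ⟩
  n % 8 + (n / 8) * 8               ≡⟨ cong (_+ (n / 8) * 8) n%8≡2 ⟩
  2 + (n / 8) * 8                   ≡⟨ cong (λ q → 2 + q * 8) (sym (ℕₚ.m+[n∸m]≡n 8≤q)) ⟩
  2 + (8 + (n / 8 ∸ 8)) * 8         ≡⟨ regroup (n / 8 ∸ 8) ⟩
  50 + (4 + (n / 8 ∸ 8) * 2) * 4    ∎)
  where
  open ≡-Reasoning
  regroup : ∀ k → 2 + (8 + k) * 8 ≡ 50 + (4 + k * 2) * 4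
  regroup = solve-∀
  8≤q : 8 ≤ n / 8
  8≤q = ℕₚ.*-cancelʳ-≤ 8 (n / 8) 8 (ℕₚ.+-cancelˡ-≤ 2 64 _
    (subst (66 ≤_) (trans (m≡m%n+[m/n]*n n 8) (cong (_+ (n / 8) * 8) n%8≡2)) 66≤n))

theorem3 : ∀ (n : ℕ) → 66 ≤ n → n % 8 ≡ 2 →
    Σ (Graph n) λ G → Snark G × StrictlyCritical G × CyclicallyConnected 5 G × Girth G 6
theorem3 n 66≤n n%8≡2 with order n 66≤n n%8≡2
... | k , refl = Realise.graph (snarkDarts (k * 2)) (snarkNumbering (k * 2))
               , Conclusion.snark k , Conclusion.strictly-critical k
               , Cyclic.cyclically-5-connected (k * 2) , GirthSix.girth-6 {k * 2}
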